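{- Let $r,s$ be positive integers and $G=\mathbb{Z}_2^r\times\mathbb{Z}_4^s$. The Laplacian polynomial of the power graph $\mathcal{G}(G)$ is \[x(x-1)^{2^{r+s}-2}(x-2)^{(2^s-1)(2^{r+s-1}-1)}(x-4)^{2^{r+s-1}(2^s-1)}(x-2-2^{r+s})^{2^s-1}(x-2^{r+2s}).\]
   Context: For a finite group $G$, the power graph $\mathcal{G}(G)$ is the simple graph with vertex set $G$ in which two distinct vertices are adjacent if and only if one is a power of the other. $\mathbb{Z}_k^t$ denotes the direct product of $t$ copies of the cyclic group $\mathbb{Z}_k$. The Laplacian polynomial of a finite simple graph $\Gamma$ is $\det(xI-L(\Gamma))$, where $L(\Gamma)=D(\Gamma)-A(\Gamma)$ is the degree diagonal matrix minus the adjacency matrix. -}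

module Defs where

open import Data.Nat as ℕ using (ℕ; zero; suc; NonZero)
open import Data.Nat.DivMod using (_mod_)
open import Data.Integer as ℤ using (ℤ; +_)
open import Data.Fin as Fin using (Fin; toℕ; punchIn)
open import Data.Vec as Vec using (Vec; []; _∷_)
open import Data.List as List using (List; []; _∷_; allFin; concatMap; cartesianProduct; upTo; length; foldr; lookup)
open import Data.Bool using (Bool; true; false; if_then_else_; _∧_; _∨_; not)
open import Data.Product using (_×_; _,_)
open import Relation.Nullary.Decidable using (⌊_⌋)
open import Data.Bool.ListAction using (any)

ZV : (k n : ℕ) → Set
ZV k n = Vec (Fin k) n

G : (r s : ℕ) → Set
G r s = ZV 2 r × ZV 4 s

addZV : ∀ {n} (k : ℕ) .{{_ : NonZero k}} → ZV k n → ZV k n → ZV k n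
addZV k []       []       = []
addZV k (a ∷ as) (b ∷ bs) = ((toℕ a ℕ.+ toℕ b) mod k) ∷ addZV k as bs

zeroZV : ∀ (k n : ℕ) .{{_ : NonZero k}} → ZV k n
zeroZV k n = Vec.replicate n (0 mod k)

_·G_ : ∀ {r s} → G r s → G r s → G r s
(a , b) ·G (c , d) = addZV 2 a c , addZV 4 b d

eG : ∀ r s → G r s
eG r s = zeroZV 2 r , zeroZV 4 s

powG : ∀ {r s} → ℕ → G r s → G r s
powG {r} {s} zero    x = eG r s
powG         (suc k) x = x ·G powG k x

eqZV : ∀ {k n} → ZV k n → ZV k n → Bool
eqZV []       []       = true
eqZV (a ∷ as) (b ∷ bs) = ⌊ a Fin.≟ b ⌋ ∧ eqZV as bs

eqG : ∀ {r s} → G r s → G r s → Bool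
eqG (a , b) (c , d) = eqZV a c ∧ eqZV b d

allZV : ∀ k n → List (ZV k n)
allZV k zero    = [] ∷ []
allZV k (suc n) = concatMap (λ a → List.map (a ∷_) (allZV k n)) (allFin k)

elems : ∀ r s → List (G r s)
elems r s = cartesianProduct (allZV 2 r) (allZV 4 s)

order : ℕ → ℕ → ℕ
order r s = length (elems r s)

-- "y is a power of x": y = x^k for some k; since x^|G| = e it suffices
-- to range over 0 ≤ k < |G|.
isPowerOf : ∀ {r s} → G r s → G r s → Bool
isPowerOf {r} {s} y x = any (λ k → eqG (powG k x) y) (upTo (order r s))

adjP : ∀ {r s} → G r s → G r s → Bool
adjP x y = not (eqG x y) ∧ (isPowerOf y x ∨ isPowerOf x y)

vtx : ∀ r s → Fin (order r s) → G r s
vtx r s = lookup (elems r s)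

b2ℤ : Bool → ℤ
b2ℤ true  = + 1
b2ℤ false = + 0

sumFin : ∀ n → (Fin n → ℤ) → ℤ
sumFin n f = foldr (λ i acc → f i ℤ.+ acc) (+ 0) (allFin n)

Adj : ∀ r s → Fin (order r s) → Fin (order r s) → ℤ
Adj r s i j = b2ℤ (adjP (vtx r s i) (vtx r s j))

Deg : ∀ r s → Fin (order r s) → ℤ
Deg r s i = sumFin (order r s) (Adj r s i)

Lap : ∀ r s → Fin (order r s) → Fin (order r s) → ℤ
Lap r s i j = (if ⌊ i Fin.≟ j ⌋ then Deg r s i else + 0) ℤ.- Adj r s i j

-- Polynomials over ℤ as coefficient lists (constant term first)

Poly : Set
Poly = List ℤ

infixl 6 _⊕_ _⊖_
infixl 7 _⊗_
infixr 8 _^P_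

coeff : Poly → ℕ → ℤ
coeff []       _       = + 0
coeff (a ∷ p)  zero    = a
coeff (a ∷ p)  (suc n) = coeff p n

_⊕_ : Poly → Poly → Poly
[]      ⊕ q       = q
p       ⊕ []      = p
(a ∷ p) ⊕ (b ∷ q) = (a ℤ.+ b) ∷ (p ⊕ q)

scale : ℤ → Poly → Poly
scale c = List.map (c ℤ.*_)

_⊗_ : Poly → Poly → Poly
[]      ⊗ q = []
(a ∷ p) ⊗ q = scale a q ⊕ (+ 0 ∷ (p ⊗ q))

_⊖_ : Poly → Poly → Poly
p ⊖ q = p ⊕ scale (ℤ.- (+ 1)) q

const : ℤ → Poly
const c = c ∷ []

X : Poly
X = + 0 ∷ + 1 ∷ []

_^P_ : Poly → ℕ → Poly
p ^P zero  = const (+ 1)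
p ^P suc n = p ⊗ (p ^P n)

lin : ℤ → Poly
lin a = X ⊖ const a

sumP : ∀ n → (Fin n → Poly) → Poly
sumP n f = foldr (λ i acc → f i ⊕ acc) [] (allFin n)

sgn : ℕ → ℤ
sgn zero          = + 1
sgn (suc zero)    = ℤ.- (+ 1)
sgn (suc (suc n)) = sgn n

det : ∀ n → (Fin n → Fin n → Poly) → Poly
det zero    M = const (+ 1)
det (suc n) M = sumP (suc n) (λ j →
  scale (sgn (toℕ j)) (M Fin.zero j ⊗ det n (λ i k → M (Fin.suc i) (punchIn j k))))

laplacianPoly : ℕ → ℕ → Poly
laplacianPoly r s = det (order r s) (λ i j →
  (if ⌊ i Fin.≟ j ⌋ then X else []) ⊖ const (Lap r s i j))

claimedPoly : ℕ → ℕ → Poly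
claimedPoly r s =
  X
  ⊗ (lin (+ 1) ^P (2 ℕ.^ (r ℕ.+ s) ℕ.∸ 2))
  ⊗ (lin (+ 2) ^P ((2 ℕ.^ s ℕ.∸ 1) ℕ.* (2 ℕ.^ (r ℕ.+ s ℕ.∸ 1) ℕ.∸ 1)))
  ⊗ (lin (+ 4) ^P (2 ℕ.^ (r ℕ.+ s ℕ.∸ 1) ℕ.* (2 ℕ.^ s ℕ.∸ 1)))
  ⊗ (lin (+ (2 ℕ.+ 2 ℕ.^ (r ℕ.+ s))) ^P (2 ℕ.^ s ℕ.∸ 1))
  ⊗ lin (+ (2 ℕ.^ (r ℕ.+ 2 ℕ.* s)))

{-# OPTIONS --safe #-}
-- The power graph of G is the comparability graph of a rooted tree: the root is the identity,
-- below it lie the involutions, and below each involution that is a square z = (0 , 2l) lie the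
-- pairs {y , y⁻¹} with y² = z, each pair being a chain of two vertices.  For a subtree of n
-- vertices at depth d, every column of xI - L restricted to the subtree sums to t = x - d, so
-- subtracting all other rows from t - 1 times the row of its root v gives
--   (t - 1) det (subtree) = t (t - n) det (subtree without v),
-- and the matrix of the subtree without v is block diagonal over the children of v.  Three
-- applications of this identity give the determinant.  Everything is done over ℤ, for
-- sufficiently large integer values of x, which determine the polynomial.
module Submission where

open import Defs
open import Data.Nat as ℕ using (ℕ; zero; suc; _≥_; z≤n; s≤s)
import Data.Nat.Divisibility as ℕ
import Data.Nat.Properties as ℕ
open import Data.Nat.Tactic.RingSolver using () renaming (solve-∀ to solve-∀ᴺ)
open import Data.Integer using (ℤ; +_; _+_; _*_; _-_; -_; _^_; ∣_∣; NonZero)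
open import Data.Integer.Properties
open import Data.Integer.Tactic.RingSolver using (solve-∀)
open import Data.Bool using (true; false; if_then_else_; _∧_; _∨_; not)
open import Data.Bool.Properties using (∨-comm; T-≡)
open import Data.Fin as Fin using (Fin; toℕ; punchIn)
open import Data.Fin.Patterns using (0F; 1F; 2F; 3F)
open import Data.List using (List; []; _∷_; _++_; map; length; foldr; tabulate; concatMap; cartesianProduct; lookup; upTo; allFin; drop)
open import Data.List.Properties using (++-assoc; length-++; length-map; length-tabulate; map-++; map-tabulate; tabulate-lookup)
open import Data.List.Membership.Propositional using (_∈_; find; lose)
open import Data.List.Membership.Propositional.Properties
open import Data.List.Relation.Unary.All as All using (_∷_; [])
open import Data.List.Relation.Unary.AllPairs using (_∷_; [])
open import Data.List.Relation.Unary.Any using (here; there)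
import Data.List.Relation.Unary.Any.Properties as Any
open import Data.List.Relation.Unary.Unique.Propositional using (Unique)
import Data.List.Relation.Unary.Unique.Propositional.Properties as Unique
open import Data.List.Relation.Binary.Permutation.Propositional as ↭ using (_↭_; prep; swap; ↭-sym; ↭-trans; ↭-refl)
import Data.List.Relation.Binary.Permutation.Propositional.Properties as ↭
open import Data.Vec using ([]; _∷_)
import Data.Vec.Properties as Vec
open import Data.Empty using (⊥)
open import Data.Product using (_×_; _,_; proj₁; proj₂; ∃)
open import Data.Sum using (_⊎_; inj₁; inj₂)
open import Function using (_∘_; id; Equivalence)
open import Relation.Nullary using (yes; no; ¬_; contradiction)
open import Relation.Nullary.Decidable using (⌊_⌋)
open import Relation.Binary.PropositionalEquality using (_≡_; _≢_; _≗_; refl; sym; trans; cong; cong₂; subst; module ≡-Reasoning)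
open ≡-Reasoning

-- Determinants

-- Coefficient lists represent a polynomial non-uniquely (trailing zeros), so ring identities
-- between them fail as equalities, and the factor t - 1 has to be cancelled. Integer values avoid
-- the first problem and reduce the second to x ≠ 1, 2, 3, one excluded value per depth. The sum t =
-- x - d involves no degrees: the columns of xI - L sum to x, its off-diagonal entries are 0 or +1,
-- and each of the d ancestors removed on the way down is adjacent to the whole subtree, so it takes
-- away 1. The sum travels down the tree as a hypothesis, and the diagonal entry of v is recovered
-- from it. Laplace expansion over `Fin` is ill suited to reordering and deleting vertices, so
-- determinants are indexed by lists of vertices instead. Mutually inverse elements generate the
-- same subgroup, so which of y and y⁻¹ stands above the other is a free choice, fixed by `canon`.

sumFinℤ : ∀ n → (Fin n → ℤ) → ℤ
sumFinℤ zero    f = + 0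
sumFinℤ (suc n) f = f Fin.zero + sumFinℤ n (f ∘ Fin.suc)

sumFinℤ-cong : ∀ n {f g : Fin n → ℤ} → f ≗ g → sumFinℤ n f ≡ sumFinℤ n g
sumFinℤ-cong zero    eq = refl
sumFinℤ-cong (suc n) eq = cong₂ _+_ (eq Fin.zero) (sumFinℤ-cong n (eq ∘ Fin.suc))

sumFinℤ-neg : ∀ n (f : Fin n → ℤ) → sumFinℤ n (-_ ∘ f) ≡ - sumFinℤ n f
sumFinℤ-neg zero    f = refl
sumFinℤ-neg (suc n) f = trans (cong (_+_ (- f Fin.zero)) (sumFinℤ-neg n (f ∘ Fin.suc))) (sym (neg-distrib-+ (f Fin.zero) _))

detF : ∀ n → (Fin n → Fin n → ℤ) → ℤ
detF zero    M = + 1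
detF (suc n) M = sumFinℤ (suc n) (λ j → sgn (toℕ j) * (M Fin.zero j * detF n (λ i k → M (Fin.suc i) (punchIn j k))))

detF-cong : ∀ n {M N : Fin n → Fin n → ℤ} → (∀ i j → M i j ≡ N i j) → detF n M ≡ detF n N
detF-cong zero    eq = refl
detF-cong (suc n) eq = sumFinℤ-cong (suc n) (λ j → cong (sgn (toℕ j) *_)
  (cong₂ _*_ (eq Fin.zero j) (detF-cong n (λ i k → eq (Fin.suc i) (punchIn j k)))))

sgn-suc : ∀ n → sgn (suc n) ≡ - sgn n
sgn-suc zero          = refl
sgn-suc (suc zero)    = refl
sgn-suc (suc (suc n)) = sgn-suc n

module _ {V : Set} where

  ∑ : List V → (V → ℤ) → ℤ
  ∑ []       f = + 0
  ∑ (x ∷ xs) f = f x + ∑ xs f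

  ∑-cong : ∀ xs {f g : V → ℤ} → (∀ {x} → x ∈ xs → f x ≡ g x) → ∑ xs f ≡ ∑ xs g
  ∑-cong []       eq = refl
  ∑-cong (x ∷ xs) eq = cong₂ _+_ (eq (here refl)) (∑-cong xs (eq ∘ there))

  ∑-zero : ∀ xs {f : V → ℤ} → (∀ {x} → x ∈ xs → f x ≡ + 0) → ∑ xs f ≡ + 0
  ∑-zero []       eq = refl
  ∑-zero (x ∷ xs) eq = cong₂ _+_ (eq (here refl)) (∑-zero xs (eq ∘ there))

  ∑-one : ∀ xs {f : V → ℤ} → (∀ {x} → x ∈ xs → f x ≡ + 1) → ∑ xs f ≡ + length xs
  ∑-one []       eq = refl
  ∑-one (x ∷ xs) eq = cong₂ _+_ (eq (here refl)) (∑-one xs (eq ∘ there))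

  ∑-++ : ∀ xs ys (f : V → ℤ) → ∑ (xs ++ ys) f ≡ ∑ xs f + ∑ ys f
  ∑-++ []       ys f = sym (+-identityˡ _)
  ∑-++ (x ∷ xs) ys f = trans (cong (_+_ (f x)) (∑-++ xs ys f)) (sym (+-assoc (f x) (∑ xs f) (∑ ys f)))

  ∑-+ : ∀ xs (f g : V → ℤ) → ∑ xs (λ x → f x + g x) ≡ ∑ xs f + ∑ xs g
  ∑-+ []       f g = refl
  ∑-+ (x ∷ xs) f g = trans (cong (_+_ (f x + g x)) (∑-+ xs f g)) (lemma (f x) (g x) (∑ xs f) (∑ xs g))
    where
    lemma : ∀ a b c d → a + b + (c + d) ≡ a + c + (b + d)
    lemma = solve-∀

  ∑-↭ : ∀ {xs ys} (f : V → ℤ) → xs ↭ ys → ∑ xs f ≡ ∑ ys f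
  ∑-↭ f ↭.refl        = refl
  ∑-↭ f (prep x p)    = cong (_+_ (f x)) (∑-↭ f p)
  ∑-↭ f (swap {xs} {ys} x y p) = trans (cong (λ t → f x + (f y + t)) (∑-↭ f p)) (lemma (f x) (f y) (∑ ys f))
    where
    lemma : ∀ a b c → a + (b + c) ≡ b + (a + c)
    lemma = solve-∀
  ∑-↭ f (↭.trans p q) = trans (∑-↭ f p) (∑-↭ f q)

  -- Interior product: contracts the first argument of the alternating form F with the row v.
  ι : (V → ℤ) → (List V → ℤ) → List V → ℤ
  ι v F []       = + 0
  ι v F (c ∷ cs) = v c * F cs - ι v (F ∘ (c ∷_)) cs

  -- Rows are functions on all of `V` and columns are a list of vertices: row operations act on
  -- functions, deleting a column is deleting a list entry, and no re-indexing by `punchIn` occurs.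
  -- Lists of unequal length give 0.
  detL : List (V → ℤ) → List V → ℤ
  detL []       []       = + 1
  detL []       (_ ∷ _)  = + 0
  detL (v ∷ vs) cs       = ι v (detL vs) cs

  ι-cong : ∀ v {F G : List V → ℤ} → F ≗ G → ι v F ≗ ι v G
  ι-cong v F≗G []       = refl
  ι-cong v F≗G (c ∷ cs) = cong₂ _-_ (cong (v c *_) (F≗G cs)) (ι-cong v (F≗G ∘ (c ∷_)) cs)

  ι-zeroʳ : ∀ v {F : List V → ℤ} → (∀ l → F l ≡ + 0) → ∀ cs → ι v F cs ≡ + 0
  ι-zeroʳ v F≡0 []       = refl
  ι-zeroʳ v F≡0 (c ∷ cs) = cong₂ _-_ (trans (cong (v c *_) (F≡0 cs)) (*-zeroʳ (v c))) (ι-zeroʳ v (F≡0 ∘ (c ∷_)) cs)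

  ι-zeroˡ : ∀ v (F : List V → ℤ) cs → (∀ {c} → c ∈ cs → v c ≡ + 0) → ι v F cs ≡ + 0
  ι-zeroˡ v F []       v≡0 = refl
  ι-zeroˡ v F (c ∷ cs) v≡0 = cong₂ _-_ (trans (cong (_* F cs) (v≡0 (here refl))) (*-zeroˡ (F cs))) (ι-zeroˡ v _ cs (v≡0 ∘ there))

  -- The shape `a * F l - G l` is that of `ι w F (c ∷ l)` with `a = w c`, so this pushes an outer
  -- contraction through an inner one.
  ι-linʳ : ∀ v a (F G : List V → ℤ) cs → ι v (λ l → a * F l - G l) cs ≡ a * ι v F cs - ι v G cs
  ι-linʳ v a F G []       = sym (cong (_- + 0) (*-zeroʳ a))
  ι-linʳ v a F G (c ∷ cs) = trans (cong (_-_ (v c * (a * F cs - G cs))) (ι-linʳ v a (F ∘ (c ∷_)) (G ∘ (c ∷_)) cs))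
                                  (lemma (v c) a (F cs) (G cs) (ι v (F ∘ (c ∷_)) cs) (ι v (G ∘ (c ∷_)) cs))
    where
    lemma : ∀ v a f g p q → v * (a * f - g) - (a * p - q) ≡ a * (v * f - p) - (v * g - q)
    lemma = solve-∀

  ι-linˡ : ∀ a b v w (F : List V → ℤ) cs → ι (λ c → a * v c + b * w c) F cs ≡ a * ι v F cs + b * ι w F cs
  ι-linˡ a b v w F []       = sym (cong₂ _+_ (*-zeroʳ a) (*-zeroʳ b))
  ι-linˡ a b v w F (c ∷ cs) = trans (cong (_-_ ((a * v c + b * w c) * F cs)) (ι-linˡ a b v w (F ∘ (c ∷_)) cs))
                                    (lemma a b (v c) (w c) (F cs) (ι v (F ∘ (c ∷_)) cs) (ι w (F ∘ (c ∷_)) cs))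
    where
    lemma : ∀ a b v w f p q → (a * v + b * w) * f - (a * p + b * q) ≡ a * (v * f - p) + b * (w * f - q)
    lemma = solve-∀

  ι-∷ : ∀ v w (F : List V → ℤ) c cs →
        ι v (ι w F) (c ∷ cs) ≡ v c * ι w F cs - (w c * ι v F cs - ι v (ι w (F ∘ (c ∷_))) cs)
  ι-∷ v w F c cs = cong (_-_ (v c * ι w F cs)) (ι-linʳ v (w c) F (ι w (F ∘ (c ∷_))) cs)

  -- At the column `c` either `v` or `w` takes it, and these two terms trade places with opposite
  -- signs, or neither does, which is the induction hypothesis for `F ∘ (c ∷_)`.
  ι-anticomm : ∀ v w (F : List V → ℤ) cs → ι v (ι w F) cs ≡ - ι w (ι v F) cs
  ι-anticomm v w F []       = refl
  ι-anticomm v w F (c ∷ cs) = begin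
    ι v (ι w F) (c ∷ cs)
      ≡⟨ ι-∷ v w F c cs ⟩
    v c * ι w F cs - (w c * ι v F cs - ι v (ι w (F ∘ (c ∷_))) cs)
      ≡⟨ cong (λ t → v c * ι w F cs - (w c * ι v F cs - t)) (ι-anticomm v w (F ∘ (c ∷_)) cs) ⟩
    v c * ι w F cs - (w c * ι v F cs - - ι w (ι v (F ∘ (c ∷_))) cs)
      ≡⟨ lemma (v c * ι w F cs) (w c * ι v F cs) (ι w (ι v (F ∘ (c ∷_))) cs) ⟩
    - (w c * ι v F cs - (v c * ι w F cs - ι w (ι v (F ∘ (c ∷_))) cs))
      ≡⟨ cong -_ (ι-∷ w v F c cs) ⟨
    - ι w (ι v F) (c ∷ cs) ∎
    where
    lemma : ∀ a b t → a - (b - - t) ≡ - (b - (a - t))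
    lemma = solve-∀

  ι-square : ∀ v (F : List V → ℤ) cs → ι v (ι v F) cs ≡ + 0
  ι-square v F []       = refl
  ι-square v F (c ∷ cs) = begin
    ι v (ι v F) (c ∷ cs)
      ≡⟨ ι-∷ v v F c cs ⟩
    v c * ι v F cs - (v c * ι v F cs - ι v (ι v (F ∘ (c ∷_))) cs)
      ≡⟨ cong (λ t → v c * ι v F cs - (v c * ι v F cs - t)) (ι-square v (F ∘ (c ∷_)) cs) ⟩
    v c * ι v F cs - (v c * ι v F cs - + 0)
      ≡⟨ lemma (v c * ι v F cs) ⟩
    + 0 ∎
    where
    lemma : ∀ a → a - (a - + 0) ≡ + 0
    lemma = solve-∀

  -- Anticommutation moves `v` inward until it meets its own copy, where `ι-square` applies.
  detL-repeat : ∀ {v vs} → v ∈ vs → ∀ cs → ι v (detL vs) cs ≡ + 0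
  detL-repeat {v} {_ ∷ vs} (here refl) cs = ι-square v (detL vs) cs
  detL-repeat {v} {w ∷ vs} (there v∈vs) cs =
    trans (ι-anticomm v w (detL vs) cs) (cong -_ (ι-zeroʳ w (detL-repeat v∈vs) cs))

  detL-swapʳᵒʷ : ∀ us v w vs cs → detL (us ++ v ∷ w ∷ vs) cs ≡ - detL (us ++ w ∷ v ∷ vs) cs
  detL-swapʳᵒʷ []       v w vs cs = ι-anticomm v w (detL vs) cs
  detL-swapʳᵒʷ (u ∷ us) v w vs cs = trans (ι-cong u (detL-swapʳᵒʷ us v w vs) cs) (ι-neg u (detL (us ++ w ∷ v ∷ vs)) cs)
    where
    ι-neg : ∀ v (F : List V → ℤ) cs → ι v (-_ ∘ F) cs ≡ - ι v F cs
    ι-neg v F cs = begin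
      ι v (-_ ∘ F) cs                      ≡⟨ ι-cong v (λ l → lemma₁ (F l)) cs ⟩
      ι v (λ l → - (+ 1) * F l - + 0) cs   ≡⟨ ι-linʳ v (- (+ 1)) F (λ _ → + 0) cs ⟩
      - (+ 1) * ι v F cs - ι v (λ _ → + 0) cs ≡⟨ cong (_-_ (- (+ 1) * ι v F cs)) (ι-zeroʳ v (λ _ → refl) cs) ⟩
      - (+ 1) * ι v F cs - + 0             ≡⟨ lemma₁ (ι v F cs) ⟨
      - ι v F cs                           ∎
      where
      lemma₁ : ∀ a → - a ≡ - (+ 1) * a - + 0
      lemma₁ = solve-∀

  Alternating : (List V → ℤ) → Set
  Alternating F = ∀ bs c d cs → F (bs ++ c ∷ d ∷ cs) ≡ - F (bs ++ d ∷ c ∷ cs)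

  ι-alternating : ∀ v {F} → Alternating F → Alternating (ι v F)
  ι-alternating v {F} alt [] c d cs = begin
    v c * F (d ∷ cs) - (v d * F (c ∷ cs) - ι v (λ l → F (c ∷ d ∷ l)) cs)
      ≡⟨ cong (λ t → v c * F (d ∷ cs) - (v d * F (c ∷ cs) - t)) flip ⟩
    v c * F (d ∷ cs) - (v d * F (c ∷ cs) - - ι v (λ l → F (d ∷ c ∷ l)) cs)
      ≡⟨ lemma₂ (v c * F (d ∷ cs)) (v d * F (c ∷ cs)) (ι v (λ l → F (d ∷ c ∷ l)) cs) ⟩
    - (v d * F (c ∷ cs) - (v c * F (d ∷ cs) - ι v (λ l → F (d ∷ c ∷ l)) cs)) ∎
    where
    lemma₁ : ∀ a → - a ≡ + 0 * a - a
    lemma₁ = solve-∀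
    lemma₂ : ∀ a b t → a - (b - - t) ≡ - (b - (a - t))
    lemma₂ = solve-∀
    flip : ι v (λ l → F (c ∷ d ∷ l)) cs ≡ - ι v (λ l → F (d ∷ c ∷ l)) cs
    flip = begin
      -- Negation is written as `+ 0 * F - F` to fit the shape handled by `ι-linʳ`.
      ι v (λ l → F (c ∷ d ∷ l)) cs ≡⟨ ι-cong v (λ l → trans (alt [] c d l) (lemma₁ (F (d ∷ c ∷ l)))) cs ⟩
      ι v (λ l → + 0 * F (d ∷ c ∷ l) - F (d ∷ c ∷ l)) cs
        ≡⟨ ι-linʳ v (+ 0) (λ l → F (d ∷ c ∷ l)) (λ l → F (d ∷ c ∷ l)) cs ⟩
      + 0 * ι v (λ l → F (d ∷ c ∷ l)) cs - ι v (λ l → F (d ∷ c ∷ l)) cs ≡⟨ lemma₁ _ ⟨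
      - ι v (λ l → F (d ∷ c ∷ l)) cs ∎
  ι-alternating v {F} alt (b ∷ bs) c d cs =
    trans (cong₂ _-_ (cong (v b *_) (alt bs c d cs)) (ι-alternating v (alt ∘ (b ∷_)) bs c d cs))
          (lemma (v b) (F (bs ++ d ∷ c ∷ cs)) (ι v (F ∘ (b ∷_)) (bs ++ d ∷ c ∷ cs)))
    where
    lemma : ∀ a f t → a * (- f) - (- t) ≡ - (a * f - t)
    lemma = solve-∀

  detL-alternating : ∀ vs → Alternating (detL vs)
  detL-alternating []       []      c d cs = refl
  detL-alternating []       (_ ∷ _) c d cs = refl
  detL-alternating (v ∷ vs) = ι-alternating v (detL-alternating vs)

  -- One row of the factorization of a block triangular determinant: `v` vanishes on `ys`, so it can
  -- only contract a column of `cs`, which leaves `n` columns in front of `ys`, where `F` already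
  -- factors. `K` stands for the determinant of the second block.
  ι-++ : ∀ v n (F G : List V → ℤ) K ys → (∀ {y} → y ∈ ys → v y ≡ + 0) →
         (∀ l → length l ≡ n → F (l ++ ys) ≡ G l * K) →
         ∀ cs → length cs ≡ suc n → ι v F (cs ++ ys) ≡ ι v G cs * K
  ι-++ v zero F G K ys v≡0 F≡GK (c ∷ []) _ = begin
    v c * F ys - ι v (F ∘ (c ∷_)) ys ≡⟨ cong₂ (λ s t → v c * s - t) (F≡GK [] refl) (ι-zeroˡ v _ ys v≡0) ⟩
    v c * (G [] * K) - + 0           ≡⟨ lemma (v c) (G []) K ⟩
    (v c * G [] - + 0) * K           ∎
    where
    lemma : ∀ a g k → a * (g * k) - + 0 ≡ (a * g - + 0) * k
    lemma = solve-∀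
  ι-++ v (suc n) F G K ys v≡0 F≡GK (c ∷ cs) len = begin
    v c * F (cs ++ ys) - ι v (F ∘ (c ∷_)) (cs ++ ys)
      ≡⟨ cong₂ (λ s t → v c * s - t) (F≡GK cs (ℕ.suc-injective len))
           (ι-++ v n (F ∘ (c ∷_)) (G ∘ (c ∷_)) K ys v≡0 (λ l eq → F≡GK (c ∷ l) (cong suc eq)) cs (ℕ.suc-injective len)) ⟩
    v c * (G cs * K) - ι v (G ∘ (c ∷_)) cs * K
      ≡⟨ lemma (v c) (G cs) K (ι v (G ∘ (c ∷_)) cs) ⟩
    (v c * G cs - ι v (G ∘ (c ∷_)) cs) * K ∎
    where
    lemma : ∀ a g k t → a * (g * k) - t * k ≡ (a * g - t) * k
    lemma = solve-∀

  detL-++ : ∀ us vs cs ys → (∀ {u y} → u ∈ us → y ∈ ys → u y ≡ + 0) → length cs ≡ length us →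
            detL (us ++ vs) (cs ++ ys) ≡ detL us cs * detL vs ys
  detL-++ []       vs [] ys u≡0 len = sym (*-identityˡ _)
  detL-++ (u ∷ us) vs cs ys u≡0 len =
    ι-++ u (length us) (detL (us ++ vs)) (detL us) (detL vs ys) ys (u≡0 (here refl))
         (λ l → detL-++ us vs l ys (u≡0 ∘ there)) cs len

  -- The nested subtractions of `ι` produce the signs of the Laplace expansion: every column passed
  -- over contributes one change of sign, matched by `sgn-suc`.
  ι-tabulate : ∀ n v (F : List V → ℤ) (c : Fin (suc n) → V) →
               sumFinℤ (suc n) (λ j → sgn (toℕ j) * (v (c j) * F (tabulate (c ∘ punchIn j)))) ≡ ι v F (tabulate c)
  ι-tabulate zero    v F c = lemma (v (c Fin.zero) * F [])
    where
    lemma : ∀ a → + 1 * a + + 0 ≡ a - + 0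
    lemma = solve-∀
  ι-tabulate (suc n) v F c = cong₂ _+_ (*-identityˡ (v (c Fin.zero) * F (tabulate (c ∘ Fin.suc)))) (begin
    sumFinℤ (suc n) (λ j → sgn (suc (toℕ j)) * t j)
      ≡⟨ sumFinℤ-cong (suc n) (λ j → trans (cong (_* t j) (sgn-suc (toℕ j))) (sym (neg-distribˡ-* (sgn (toℕ j)) (t j)))) ⟩
    sumFinℤ (suc n) (λ j → - (sgn (toℕ j) * t j))
      ≡⟨ sumFinℤ-neg (suc n) (λ j → sgn (toℕ j) * t j) ⟩
    - sumFinℤ (suc n) (λ j → sgn (toℕ j) * t j)
      ≡⟨ cong -_ (ι-tabulate n v (F ∘ (c Fin.zero ∷_)) (c ∘ Fin.suc)) ⟩
    - ι v (F ∘ (c Fin.zero ∷_)) (tabulate (c ∘ Fin.suc)) ∎)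
    where
    t : Fin (suc n) → ℤ
    t j = v (c (Fin.suc j)) * F (c Fin.zero ∷ tabulate (c ∘ Fin.suc ∘ punchIn j))

  detF-tabulate : ∀ n (g : Fin n → V → ℤ) (c : Fin n → V) →
                  detF n (λ i j → g i (c j)) ≡ detL (tabulate g) (tabulate c)
  detF-tabulate zero    g c = refl
  detF-tabulate (suc n) g c = trans
    (sumFinℤ-cong (suc n) (λ j → cong (λ t → sgn (toℕ j) * (g Fin.zero (c j) * t)) (detF-tabulate n (g ∘ Fin.suc) (c ∘ punchIn j))))
    (ι-tabulate n (g Fin.zero) (detL (tabulate (g ∘ Fin.suc))) c)

  -- Principal minors indexed by lists of vertices

  module Submatrix (f : V → V → ℤ) where

    D : List V → ℤ
    D xs = detL (map f xs) xs

    -- Rows and columns are exchanged together, so the two signs cancel; this makes `D` a function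
    -- of the vertex set alone.
    D-swap : ∀ ws x y zs → D (ws ++ x ∷ y ∷ zs) ≡ D (ws ++ y ∷ x ∷ zs)
    D-swap ws x y zs = begin
      detL (map f (ws ++ x ∷ y ∷ zs)) (ws ++ x ∷ y ∷ zs)
        ≡⟨ cong (λ r → detL r (ws ++ x ∷ y ∷ zs)) (map-++ f ws (x ∷ y ∷ zs)) ⟩
      detL (map f ws ++ f x ∷ f y ∷ map f zs) (ws ++ x ∷ y ∷ zs)
        ≡⟨ detL-swapʳᵒʷ (map f ws) (f x) (f y) (map f zs) (ws ++ x ∷ y ∷ zs) ⟩
      - detL (map f ws ++ f y ∷ f x ∷ map f zs) (ws ++ x ∷ y ∷ zs)
        ≡⟨ cong -_ (detL-alternating (map f ws ++ f y ∷ f x ∷ map f zs) ws x y zs) ⟩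
      - - detL (map f ws ++ f y ∷ f x ∷ map f zs) (ws ++ y ∷ x ∷ zs)
        ≡⟨ neg-involutive _ ⟩
      detL (map f ws ++ f y ∷ f x ∷ map f zs) (ws ++ y ∷ x ∷ zs)
        ≡⟨ cong (λ r → detL r (ws ++ y ∷ x ∷ zs)) (map-++ f ws (y ∷ x ∷ zs)) ⟨
      detL (map f (ws ++ y ∷ x ∷ zs)) (ws ++ y ∷ x ∷ zs) ∎

    D-↭ : ∀ {xs ys} → xs ↭ ys → D xs ≡ D ys
    D-↭ = go []
      where
      -- The prefix `ws` collects the entries already passed: `D (x ∷ xs)` is not determined by
      -- `D xs`, so the induction cannot simply strip a common head.
      go : ∀ ws {xs ys} → xs ↭ ys → D (ws ++ xs) ≡ D (ws ++ ys)
      go ws ↭.refl                  = refl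
      go ws (prep {xs} {ys} x p)    = begin
        D (ws ++ x ∷ xs)        ≡⟨ cong D (++-assoc ws (x ∷ []) xs) ⟨
        D ((ws ++ x ∷ []) ++ xs) ≡⟨ go (ws ++ x ∷ []) p ⟩
        D ((ws ++ x ∷ []) ++ ys) ≡⟨ cong D (++-assoc ws (x ∷ []) ys) ⟩
        D (ws ++ x ∷ ys)        ∎
      go ws (swap {xs} {ys} x y p)  = begin
        D (ws ++ x ∷ y ∷ xs)         ≡⟨ D-swap ws x y xs ⟩
        D (ws ++ y ∷ x ∷ xs)         ≡⟨ cong D (++-assoc ws (y ∷ x ∷ []) xs) ⟨
        D ((ws ++ y ∷ x ∷ []) ++ xs) ≡⟨ go (ws ++ y ∷ x ∷ []) p ⟩
        D ((ws ++ y ∷ x ∷ []) ++ ys) ≡⟨ cong D (++-assoc ws (y ∷ x ∷ []) ys) ⟩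
        D (ws ++ y ∷ x ∷ ys)         ∎
      go ws (↭.trans p q)           = trans (go ws p) (go ws q)

    Zero : List V → List V → Set
    Zero xs ys = ∀ {x y} → x ∈ xs → y ∈ ys → f x y ≡ + 0

    -- The invariant carried down the tree, `y` being t: it drops by 1 when the top vertex of a
    -- subtree is removed and is inherited unchanged by each diagonal block.
    ColSum : List V → ℤ → Set
    ColSum xs y = ∀ {w} → w ∈ xs → ∑ xs (λ u → f u w) ≡ y

    D-++ : ∀ xs ys → Zero xs ys → D (xs ++ ys) ≡ D xs * D ys
    D-++ xs ys zr = trans (cong (λ r → detL r (xs ++ ys)) (map-++ f xs ys))
      (detL-++ (map f xs) (map f ys) xs ys zr′ (sym (length-map f xs)))
      where
      zr′ : ∀ {u y} → u ∈ map f xs → y ∈ ys → u y ≡ + 0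
      zr′ u∈ y∈ with _ , x∈ , refl ← ∈-map⁻ f u∈ = zr x∈ y∈

    D-[] : ∀ v {y} → ColSum (v ∷ []) y → D (v ∷ []) ≡ y
    D-[] v sums = trans (lemma (f v v)) (sums (here refl))
      where
      lemma : ∀ a → a * + 1 - + 0 ≡ a + + 0
      lemma = solve-∀

    ColSum-++ˡ : ∀ xs ys {y} → Zero ys xs → ColSum (xs ++ ys) y → ColSum xs y
    ColSum-++ˡ xs ys {y} zr sums {w} w∈ = begin
      ∑ xs (λ u → f u w)                      ≡⟨ +-identityʳ _ ⟨
      ∑ xs (λ u → f u w) + + 0                ≡⟨ cong (_+_ (∑ xs (λ u → f u w))) (∑-zero ys (λ x∈ → zr x∈ w∈)) ⟨
      ∑ xs (λ u → f u w) + ∑ ys (λ u → f u w) ≡⟨ ∑-++ xs ys _ ⟨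
      ∑ (xs ++ ys) (λ u → f u w)              ≡⟨ sums (∈-++⁺ˡ w∈) ⟩
      y ∎

    ColSum-++ʳ : ∀ xs ys {y} → Zero xs ys → ColSum (xs ++ ys) y → ColSum ys y
    ColSum-++ʳ xs ys {y} zr sums {w} w∈ = begin
      ∑ ys (λ u → f u w)                      ≡⟨ +-identityˡ _ ⟨
      + 0 + ∑ ys (λ u → f u w)                ≡⟨ cong (_+ ∑ ys (λ u → f u w)) (∑-zero xs (λ x∈ → zr x∈ w∈)) ⟨
      ∑ xs (λ u → f u w) + ∑ ys (λ u → f u w) ≡⟨ ∑-++ xs ys _ ⟨
      ∑ (xs ++ ys) (λ u → f u w)              ≡⟨ sums (∈-++⁺ʳ xs w∈) ⟩
      y ∎

    ColSum-tail : ∀ v vs {y} → (∀ {u} → u ∈ vs → f v u ≡ + 1) → ColSum (v ∷ vs) y → ColSum vs (y - + 1)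
    ColSum-tail v vs {y} fv sums {w} w∈ = begin
      ∑ vs (λ u → f u w)                     ≡⟨ lemma (∑ vs (λ u → f u w)) ⟩
      + 1 + ∑ vs (λ u → f u w) - + 1         ≡⟨ cong (λ t → t + ∑ vs (λ u → f u w) - + 1) (fv w∈) ⟨
      f v w + ∑ vs (λ u → f u w) - + 1       ≡⟨ cong (_- + 1) (sums (there w∈)) ⟩
      y - + 1 ∎
      where
      lemma : ∀ a → a ≡ + 1 + a - + 1
      lemma = solve-∀

    -- Replace row v by (y - 1) · row v - Σ (other rows): only its first entry survives.
    D-cone : ∀ v vs {y} → (∀ {u} → u ∈ vs → f v u ≡ + 1) → (∀ {u} → u ∈ vs → f u v ≡ + 1) →
             ColSum (v ∷ vs) y →
             (y - + 1) * D (v ∷ vs) ≡ y * (y - + suc (length vs)) * D vs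
    D-cone v vs {y} fv vf sums = begin
      (y - + 1) * D (v ∷ vs)
        ≡⟨ +-identityʳ _ ⟨
      (y - + 1) * ι (f v) F (v ∷ vs) + - (+ 1) * + 0
        ≡⟨ cong (λ t → (y - + 1) * ι (f v) F (v ∷ vs) + - (+ 1) * t) (others vs id) ⟨
      (y - + 1) * ι (f v) F (v ∷ vs) + - (+ 1) * ι g F (v ∷ vs)
        ≡⟨ ι-linˡ (y - + 1) (- (+ 1)) (f v) g F (v ∷ vs) ⟨
      h v * D vs - ι h (F ∘ (v ∷_)) vs
        ≡⟨ cong (_-_ (h v * D vs)) (ι-zeroˡ h _ vs h-zero) ⟩
      h v * D vs - + 0
        ≡⟨ +-identityʳ _ ⟩
      h v * D vs
        ≡⟨ cong (_* D vs) h-v ⟩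
      y * (y - + suc (length vs)) * D vs ∎
      where
      F : List V → ℤ
      F = detL (map f vs)
      g h : V → ℤ
      g w = ∑ vs (λ u → f u w)
      h w = (y - + 1) * f v w + - (+ 1) * g w

      -- Subtracting the other rows changes nothing, since each of them already occurs in `F`. The
      -- sum runs over a sublist `us` so that the induction can shrink it while the form `F` stays
      -- fixed.
      others : ∀ us → (∀ {u} → u ∈ us → u ∈ vs) → ι (λ w → ∑ us (λ u → f u w)) F (v ∷ vs) ≡ + 0
      others []       us⊆vs = ι-zeroˡ (λ _ → + 0) F (v ∷ vs) (λ _ → refl)
      others (u ∷ us) us⊆vs = begin
        ι (λ w → f u w + ∑ us (λ x → f x w)) F (v ∷ vs)
          ≡⟨ ι-congˡ (λ w → sym (cong₂ _+_ (*-identityˡ (f u w)) (*-identityˡ (∑ us (λ x → f x w))))) F (v ∷ vs) ⟩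
        ι (λ w → + 1 * f u w + + 1 * ∑ us (λ x → f x w)) F (v ∷ vs)
          ≡⟨ ι-linˡ (+ 1) (+ 1) (f u) (λ w → ∑ us (λ x → f x w)) F (v ∷ vs) ⟩
        + 1 * ι (f u) F (v ∷ vs) + + 1 * ι (λ w → ∑ us (λ x → f x w)) F (v ∷ vs)
          ≡⟨ cong₂ (λ a b → + 1 * a + + 1 * b) (detL-repeat (∈-map⁺ f (us⊆vs (here refl))) (v ∷ vs)) (others us (us⊆vs ∘ there)) ⟩
        + 0 ∎
        where
        ι-congˡ : ∀ {v w : V → ℤ} → v ≗ w → ∀ F cs → ι v F cs ≡ ι w F cs
        ι-congˡ v≗w F []       = refl
        ι-congˡ v≗w F (c ∷ cs) = cong₂ _-_ (cong (_* F cs) (v≗w c)) (ι-congˡ v≗w _ cs)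

      h-zero : ∀ {u} → u ∈ vs → h u ≡ + 0
      h-zero {u} u∈ = trans (cong₂ (λ a b → (y - + 1) * a + - (+ 1) * b) (fv u∈) (ColSum-tail v vs fv sums u∈)) (lemma y)
        where
        lemma : ∀ y → (y - + 1) * + 1 + - (+ 1) * (y - + 1) ≡ + 0
        lemma = solve-∀

      -- The diagonal entry comes from the column sum, which replaces any computation of the degree
      -- of `v`.
      diag : f v v ≡ y - + length vs
      diag = begin
        f v v                                        ≡⟨ lemma (f v v) (g v) ⟩
        f v v + g v - g v                            ≡⟨ cong₂ _-_ (sums (here refl)) (∑-one vs vf) ⟩
        y - + length vs ∎
        where
        lemma : ∀ a b → a ≡ a + b - b
        lemma = solve-∀

      h-v : h v ≡ y * (y - + suc (length vs))
      h-v = trans (cong₂ (λ a b → (y - + 1) * a + - (+ 1) * b) diag (∑-one vs vf)) (lemma y (+ length vs))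
        where
        lemma : ∀ y k → (y - + 1) * (y - k) + - (+ 1) * k ≡ y * (y - (+ 1 + k))
        lemma = solve-∀

    -- Subtrees of the same shape below one vertex: the matrix is block diagonal, and every block
    -- inherits the column sum `y`, so the value `d` may be derived from that sum. `Unique is`
    -- ensures that different positions carry different indices, which is what the vanishing
    -- hypothesis speaks of.
    D-concatMap : ∀ {I : Set} (b : I → List V) is {y d} → Unique is →
      (∀ {i j} → i ∈ is → j ∈ is → i ≢ j → Zero (b i) (b j)) →
      ColSum (concatMap b is) y →
      (∀ {i} → i ∈ is → ColSum (b i) y → D (b i) ≡ d) →
      D (concatMap b is) ≡ d ^ length is
    D-concatMap b []       _          zr sums block = refl
    D-concatMap b (i ∷ is) {y} {d} (i∉ ∷ uq) zr sums block = begin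
      D (b i ++ concatMap b is)
        ≡⟨ D-++ (b i) (concatMap b is) zr₁ ⟩
      D (b i) * D (concatMap b is)
        ≡⟨ cong₂ _*_ (block (here refl) (ColSum-++ˡ (b i) (concatMap b is) zr₂ sums))
                     (D-concatMap b is uq (λ p q → zr (there p) (there q))
                       (ColSum-++ʳ (b i) (concatMap b is) zr₁ sums) (block ∘ there)) ⟩
      d * d ^ length is ∎
      where
      zr₁ : Zero (b i) (concatMap b is)
      zr₁ x∈ y∈ with j , j∈ , y∈bj ← find (∈-concatMap⁻ b y∈) = zr (here refl) (there j∈) (All.lookup i∉ j∈) x∈ y∈bj
      zr₂ : Zero (concatMap b is) (b i)
      zr₂ x∈ y∈ with j , j∈ , x∈bj ← find (∈-concatMap⁻ b x∈) = zr (there j∈) (here refl) (All.lookup i∉ j∈ ∘ sym) x∈bj y∈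

-- Evaluation of polynomials

eval : ℤ → Poly → ℤ
eval x []      = + 0
eval x (a ∷ p) = a + x * eval x p

eval-⊕ : ∀ x p q → eval x (p ⊕ q) ≡ eval x p + eval x q
eval-⊕ x []      q       = sym (+-identityˡ _)
eval-⊕ x (a ∷ p) []      = sym (+-identityʳ _)
eval-⊕ x (a ∷ p) (b ∷ q) = trans (cong (λ t → a + b + x * t) (eval-⊕ x p q)) (lemma a b x (eval x p) (eval x q))
  where
  lemma : ∀ a b x p q → a + b + x * (p + q) ≡ a + x * p + (b + x * q)
  lemma = solve-∀

eval-scale : ∀ x c p → eval x (scale c p) ≡ c * eval x p
eval-scale x c []      = sym (*-zeroʳ c)
eval-scale x c (a ∷ p) = trans (cong (λ t → c * a + x * t) (eval-scale x c p)) (lemma c a x (eval x p))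
  where
  lemma : ∀ c a x p → c * a + x * (c * p) ≡ c * (a + x * p)
  lemma = solve-∀

eval-⊗ : ∀ x p q → eval x (p ⊗ q) ≡ eval x p * eval x q
eval-⊗ x []      q = refl
eval-⊗ x (a ∷ p) q = begin
  eval x (scale a q ⊕ (+ 0 ∷ (p ⊗ q)))                ≡⟨ eval-⊕ x (scale a q) (+ 0 ∷ (p ⊗ q)) ⟩
  eval x (scale a q) + (+ 0 + x * eval x (p ⊗ q))     ≡⟨ cong₂ (λ s t → s + (+ 0 + x * t)) (eval-scale x a q) (eval-⊗ x p q) ⟩
  a * eval x q + (+ 0 + x * (eval x p * eval x q))    ≡⟨ lemma a x (eval x p) (eval x q) ⟩
  (a + x * eval x p) * eval x q                       ∎
  where
  lemma : ∀ a x p q → a * q + (+ 0 + x * (p * q)) ≡ (a + x * p) * q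
  lemma = solve-∀

eval-⊖ : ∀ x p q → eval x (p ⊖ q) ≡ eval x p - eval x q
eval-⊖ x p q = trans (eval-⊕ x p (scale (- (+ 1)) q)) (cong (_+_ (eval x p)) (trans (eval-scale x (- (+ 1)) q) (-1*i≡-i (eval x q))))

eval-const : ∀ x c → eval x (const c) ≡ c
eval-const x c = trans (cong (_+_ c) (*-zeroʳ x)) (+-identityʳ c)

eval-X : ∀ x → eval x X ≡ x
eval-X = lemma
  where
  lemma : ∀ x → + 0 + x * (+ 1 + x * + 0) ≡ x
  lemma = solve-∀

eval-lin : ∀ x a → eval x (lin a) ≡ x - a
eval-lin x a = trans (eval-⊖ x X (const a)) (cong₂ _-_ (eval-X x) (eval-const x a))

eval-^P : ∀ x p n → eval x (p ^P n) ≡ eval x p ^ n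
eval-^P x p zero    = eval-const x (+ 1)
eval-^P x p (suc n) = trans (eval-⊗ x p (p ^P n)) (cong (eval x p *_) (eval-^P x p n))

eval-sumP : ∀ x n (f : Fin n → Poly) → eval x (sumP n f) ≡ sumFinℤ n (eval x ∘ f)
eval-sumP x n f = go n id
  where
  go : ∀ m (h : Fin m → Fin n) → eval x (foldr (λ i acc → f i ⊕ acc) [] (tabulate h)) ≡ sumFinℤ m (eval x ∘ f ∘ h)
  go zero    h = refl
  go (suc m) h = trans (eval-⊕ x (f (h Fin.zero)) _) (cong (_+_ (eval x (f (h Fin.zero)))) (go m (h ∘ Fin.suc)))

eval-det : ∀ x n M → eval x (det n M) ≡ detF n (λ i j → eval x (M i j))
eval-det x zero    M = eval-const x (+ 1)
eval-det x (suc n) M = trans (eval-sumP x (suc n) (λ j → scale (sgn (toℕ j)) (term j))) (sumFinℤ-cong (suc n) (λ j →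
  trans (eval-scale x (sgn (toℕ j)) (term j))
        (cong (sgn (toℕ j) *_) (trans (eval-⊗ x (M Fin.zero j) (det n (minor j)))
                                      (cong (eval x (M Fin.zero j) *_) (eval-det x n (minor j)))))))
  where
  minor : Fin (suc n) → Fin n → Fin n → Poly
  minor j i k = M (Fin.suc i) (punchIn j k)
  term : Fin (suc n) → Poly
  term j = M Fin.zero j ⊗ det n (minor j)

coeff-⊕ : ∀ p q k → coeff (p ⊕ q) k ≡ coeff p k + coeff q k
coeff-⊕ []      q       k       = sym (+-identityˡ _)
coeff-⊕ (a ∷ p) []      k       = sym (+-identityʳ _)
coeff-⊕ (a ∷ p) (b ∷ q) zero    = refl
coeff-⊕ (a ∷ p) (b ∷ q) (suc k) = coeff-⊕ p q k

coeff-scale : ∀ c p k → coeff (scale c p) k ≡ c * coeff p k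
coeff-scale c []      k       = sym (*-zeroʳ c)
coeff-scale c (a ∷ p) zero    = refl
coeff-scale c (a ∷ p) (suc k) = coeff-scale c p k

-- If n > |a| and n divides a, then a = 0; so the constant term vanishes, and one can divide by n.
eventually-zero⇒coeff≡0 : ∀ p N → (∀ n → n ≥ N → eval (+ n) p ≡ + 0) → ∀ k → coeff p k ≡ + 0
eventually-zero⇒coeff≡0 []      N p≡0 k = refl
eventually-zero⇒coeff≡0 (a ∷ p) N p≡0 = λ { zero → a≡0 ; (suc k) → eventually-zero⇒coeff≡0 p (suc N) q≡0 k }
  where
  n : ℕ
  n = suc (N ℕ.+ ∣ a ∣)
  n∣a : n ℕ.∣ ∣ a ∣
  n∣a = ℕ.divides ∣ eval (+ n) p ∣ (begin
    ∣ a ∣                        ≡⟨ cong ∣_∣ (lemma a (+ n * eval (+ n) p)) ⟩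
    ∣ a + + n * eval (+ n) p - + n * eval (+ n) p ∣ ≡⟨ cong (λ t → ∣ t - + n * eval (+ n) p ∣) (p≡0 n (ℕ.m≤n⇒m≤1+n (ℕ.m≤m+n N ∣ a ∣))) ⟩
    ∣ + 0 - + n * eval (+ n) p ∣ ≡⟨ cong ∣_∣ (+-identityˡ (- (+ n * eval (+ n) p))) ⟩
    ∣ - (+ n * eval (+ n) p) ∣   ≡⟨ ∣-i∣≡∣i∣ (+ n * eval (+ n) p) ⟩
    ∣ + n * eval (+ n) p ∣       ≡⟨ abs-* (+ n) (eval (+ n) p) ⟩
    n ℕ.* ∣ eval (+ n) p ∣       ≡⟨ ℕ.*-comm n _ ⟩
    ∣ eval (+ n) p ∣ ℕ.* n       ∎)
    where
    lemma : ∀ a b → a ≡ a + b - b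
    lemma = solve-∀
  small : ∀ m → n ℕ.∣ m → m ℕ.< n → m ≡ 0
  small zero    _   _   = refl
  small (suc m) n∣m m<n with () ← ℕ.>⇒∤ m<n n∣m
  a≡0 : a ≡ + 0
  a≡0 = ∣i∣≡0⇒i≡0 (small ∣ a ∣ n∣a (ℕ.s≤s (ℕ.m≤n+m ∣ a ∣ N)))
  -- The bound is raised to `suc N` so that `m` is positive and can be cancelled.
  q≡0 : ∀ m → m ≥ suc N → eval (+ m) p ≡ + 0
  q≡0 (suc m) m≥ = *-cancelˡ-≡ (+ suc m) (eval (+ suc m) p) (+ 0) (begin
    + suc m * eval (+ suc m) p     ≡⟨ +-identityˡ _ ⟨
    + 0 + + suc m * eval (+ suc m) p ≡⟨ cong (_+ + suc m * eval (+ suc m) p) a≡0 ⟨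
    a + + suc m * eval (+ suc m) p ≡⟨ p≡0 (suc m) (ℕ.<⇒≤ m≥) ⟩
    + 0                            ≡⟨ *-zeroʳ (+ suc m) ⟨
    + suc m * + 0                  ∎)

eventually-equal⇒coeff≡ : ∀ p q N → (∀ n → n ≥ N → eval (+ n) p ≡ eval (+ n) q) → ∀ k → coeff p k ≡ coeff q k
eventually-equal⇒coeff≡ p q N p≡q k = i-j≡0⇒i≡j (coeff p k) (coeff q k) (begin
  coeff p k - coeff q k                   ≡⟨ cong (_+_ (coeff p k)) (trans (coeff-scale (- (+ 1)) q k) (-1*i≡-i (coeff q k))) ⟨
  coeff p k + coeff (scale (- (+ 1)) q) k ≡⟨ coeff-⊕ p (scale (- (+ 1)) q) k ⟨
  coeff (p ⊖ q) k                         ≡⟨ eventually-zero⇒coeff≡0 (p ⊖ q) N vanish k ⟩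
  + 0 ∎)
  where
  vanish : ∀ n → n ≥ N → eval (+ n) (p ⊖ q) ≡ + 0
  vanish n n≥N = trans (eval-⊖ (+ n) p q) (i≡j⇒i-j≡0 (p≡q n n≥N))

-- Arithmetic in G

eqZV-refl : ∀ {k n} (a : ZV k n) → eqZV a a ≡ true
eqZV-refl []      = refl
eqZV-refl (x ∷ a) with x Fin.≟ x
... | yes _  = eqZV-refl a
... | no x≢x = contradiction refl x≢x

eqZV⇒≡ : ∀ {k n} (a b : ZV k n) → eqZV a b ≡ true → a ≡ b
eqZV⇒≡ []      []      _  = refl
eqZV⇒≡ (x ∷ a) (y ∷ b) eq with x Fin.≟ y
... | yes refl = cong (x ∷_) (eqZV⇒≡ a b eq)

∧-true : ∀ {a b} → a ∧ b ≡ true → a ≡ true × b ≡ true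
∧-true {true} {true} _ = refl , refl

∨-true : ∀ {a b} → a ∨ b ≡ true → a ≡ true ⊎ b ≡ true
∨-true {true}  _  = inj₁ refl
∨-true {false} eq = inj₂ eq

module _ {r s : ℕ} where

  eqG-refl : (x : G r s) → eqG x x ≡ true
  eqG-refl (a , b) = cong₂ _∧_ (eqZV-refl a) (eqZV-refl b)

  eqG⇒≡ : (x y : G r s) → eqG x y ≡ true → x ≡ y
  eqG⇒≡ (a , b) (c , d) eq = cong₂ _,_ (eqZV⇒≡ a c (proj₁ (∧-true eq))) (eqZV⇒≡ b d (proj₂ (∧-true {eqZV a c} eq)))

  ≢⇒eqG : (x y : G r s) → x ≢ y → eqG x y ≡ false
  ≢⇒eqG x y x≢y with eqG x y in eq
  ... | true  = contradiction (eqG⇒≡ x y eq) x≢y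
  ... | false = refl

  eqG-sym : (x y : G r s) → eqG x y ≡ eqG y x
  eqG-sym x y with eqG x y in eq
  ... | true  rewrite eqG⇒≡ x y eq = sym (eqG-refl y)
  ... | false = sym (≢⇒eqG y x (λ { refl → case-false (trans (sym eq) (eqG-refl x)) }))
    where
    case-false : false ≢ true
    case-false ()

  adjP-sym : (x y : G r s) → adjP x y ≡ adjP y x
  adjP-sym x y = cong₂ (λ p q → not p ∧ q) (eqG-sym x y) (∨-comm (isPowerOf y x) (isPowerOf x y))

-- Reduction modulo 2. The double of `b` depends only on it (`addZV₄-self`), so it labels the square
-- of an element and, when nonzero, the star containing that element.
lowBits : ∀ {n} → ZV 4 n → ZV 2 n
lowBits []       = []
lowBits (0F ∷ b) = 0F ∷ lowBits b
lowBits (1F ∷ b) = 1F ∷ lowBits b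
lowBits (2F ∷ b) = 0F ∷ lowBits b
lowBits (3F ∷ b) = 1F ∷ lowBits b

double : ∀ {n} → ZV 2 n → ZV 4 n
double []       = []
double (0F ∷ h) = 0F ∷ double h
double (1F ∷ h) = 2F ∷ double h

neg : ∀ {n} → ZV 4 n → ZV 4 n
neg []       = []
neg (0F ∷ b) = 0F ∷ neg b
neg (1F ∷ b) = 3F ∷ neg b
neg (2F ∷ b) = 2F ∷ neg b
neg (3F ∷ b) = 1F ∷ neg b

-- The one of b and - b whose first odd entry is 1.
canon : ∀ {n} → ZV 4 n → ZV 4 n
canon []       = []
canon (0F ∷ b) = 0F ∷ canon b
canon (1F ∷ b) = 1F ∷ b
canon (2F ∷ b) = 2F ∷ canon b
canon (3F ∷ b) = 1F ∷ neg b

0₂ : ∀ {n} → ZV 2 n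
0₂ {n} = zeroZV 2 n

0₄ : ∀ {n} → ZV 4 n
0₄ {n} = zeroZV 4 n

neg-neg : ∀ {n} (b : ZV 4 n) → neg (neg b) ≡ b
neg-neg []       = refl
neg-neg (0F ∷ b) = cong (0F ∷_) (neg-neg b)
neg-neg (1F ∷ b) = cong (1F ∷_) (neg-neg b)
neg-neg (2F ∷ b) = cong (2F ∷_) (neg-neg b)
neg-neg (3F ∷ b) = cong (3F ∷_) (neg-neg b)

canon-neg : ∀ {n} (b : ZV 4 n) → canon (neg b) ≡ canon b
canon-neg []       = refl
canon-neg (0F ∷ b) = cong (0F ∷_) (canon-neg b)
canon-neg (1F ∷ b) = cong (1F ∷_) (neg-neg b)
canon-neg (2F ∷ b) = cong (2F ∷_) (canon-neg b)
canon-neg (3F ∷ b) = refl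

canon-cases : ∀ {n} (b : ZV 4 n) → b ≡ canon b ⊎ b ≡ neg (canon b)
canon-cases []       = inj₁ refl
canon-cases (1F ∷ b) = inj₁ refl
canon-cases (3F ∷ b) = inj₂ (cong (3F ∷_) (sym (neg-neg b)))
canon-cases (0F ∷ b) with canon-cases b
... | inj₁ p = inj₁ (cong (0F ∷_) p)
... | inj₂ p = inj₂ (cong (0F ∷_) p)
canon-cases (2F ∷ b) with canon-cases b
... | inj₁ p = inj₁ (cong (2F ∷_) p)
... | inj₂ p = inj₂ (cong (2F ∷_) p)

lowBits-neg : ∀ {n} (b : ZV 4 n) → lowBits (neg b) ≡ lowBits b
lowBits-neg []       = refl
lowBits-neg (0F ∷ b) = cong (0F ∷_) (lowBits-neg b)
lowBits-neg (1F ∷ b) = cong (1F ∷_) (lowBits-neg b)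
lowBits-neg (2F ∷ b) = cong (0F ∷_) (lowBits-neg b)
lowBits-neg (3F ∷ b) = cong (1F ∷_) (lowBits-neg b)

lowBits-double : ∀ {n} (h : ZV 2 n) → lowBits (double h) ≡ 0₂
lowBits-double []       = refl
lowBits-double (0F ∷ h) = cong (0F ∷_) (lowBits-double h)
lowBits-double (1F ∷ h) = cong (0F ∷_) (lowBits-double h)

double-injective : ∀ {n} {h k : ZV 2 n} → double h ≡ double k → h ≡ k
double-injective {h = []}     {[]}     _  = refl
double-injective {h = 0F ∷ h} {0F ∷ k} eq = cong (0F ∷_) (double-injective (Vec.∷-injectiveʳ eq))
double-injective {h = 1F ∷ h} {1F ∷ k} eq = cong (1F ∷_) (double-injective (Vec.∷-injectiveʳ eq))
double-injective {h = 0F ∷ h} {1F ∷ k} ()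
double-injective {h = 1F ∷ h} {0F ∷ k} ()

double-0 : ∀ n → double (0₂ {n}) ≡ 0₄
double-0 zero    = refl
double-0 (suc n) = cong (0F ∷_) (double-0 n)

lowBits≡0⇒double : ∀ {n} (b : ZV 4 n) → lowBits b ≡ 0₂ → ∃ λ h → b ≡ double h
lowBits≡0⇒double []       _  = [] , refl
lowBits≡0⇒double (0F ∷ b) eq with h , p ← lowBits≡0⇒double b (Vec.∷-injectiveʳ eq) = 0F ∷ h , cong (0F ∷_) p
lowBits≡0⇒double (1F ∷ b) ()
lowBits≡0⇒double (2F ∷ b) eq with h , p ← lowBits≡0⇒double b (Vec.∷-injectiveʳ eq) = 1F ∷ h , cong (2F ∷_) p
lowBits≡0⇒double (3F ∷ b) ()

neg-double : ∀ {n} (h : ZV 2 n) → neg (double h) ≡ double h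
neg-double []       = refl
neg-double (0F ∷ h) = cong (0F ∷_) (neg-double h)
neg-double (1F ∷ h) = cong (2F ∷_) (neg-double h)

neg≡⇒lowBits≡0 : ∀ {n} (b : ZV 4 n) → neg b ≡ b → lowBits b ≡ 0₂
neg≡⇒lowBits≡0 []       _  = refl
neg≡⇒lowBits≡0 (0F ∷ b) eq = cong (0F ∷_) (neg≡⇒lowBits≡0 b (Vec.∷-injectiveʳ eq))
neg≡⇒lowBits≡0 (2F ∷ b) eq = cong (0F ∷_) (neg≡⇒lowBits≡0 b (Vec.∷-injectiveʳ eq))
neg≡⇒lowBits≡0 (1F ∷ b) ()
neg≡⇒lowBits≡0 (3F ∷ b) ()

addZV₂-0 : ∀ {n} (a : ZV 2 n) → addZV 2 a 0₂ ≡ a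
addZV₂-0 []       = refl
addZV₂-0 (0F ∷ a) = cong (0F ∷_) (addZV₂-0 a)
addZV₂-0 (1F ∷ a) = cong (1F ∷_) (addZV₂-0 a)

addZV₂-self : ∀ {n} (a : ZV 2 n) → addZV 2 a a ≡ 0₂
addZV₂-self []       = refl
addZV₂-self (0F ∷ a) = cong (0F ∷_) (addZV₂-self a)
addZV₂-self (1F ∷ a) = cong (0F ∷_) (addZV₂-self a)

addZV₄-0 : ∀ {n} (b : ZV 4 n) → addZV 4 b 0₄ ≡ b
addZV₄-0 []       = refl
addZV₄-0 (0F ∷ b) = cong (0F ∷_) (addZV₄-0 b)
addZV₄-0 (1F ∷ b) = cong (1F ∷_) (addZV₄-0 b)
addZV₄-0 (2F ∷ b) = cong (2F ∷_) (addZV₄-0 b)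
addZV₄-0 (3F ∷ b) = cong (3F ∷_) (addZV₄-0 b)

addZV₄-self : ∀ {n} (b : ZV 4 n) → addZV 4 b b ≡ double (lowBits b)
addZV₄-self []       = refl
addZV₄-self (0F ∷ b) = cong (0F ∷_) (addZV₄-self b)
addZV₄-self (1F ∷ b) = cong (2F ∷_) (addZV₄-self b)
addZV₄-self (2F ∷ b) = cong (0F ∷_) (addZV₄-self b)
addZV₄-self (3F ∷ b) = cong (2F ∷_) (addZV₄-self b)

addZV₄-double : ∀ {n} (b : ZV 4 n) → addZV 4 b (double (lowBits b)) ≡ neg b
addZV₄-double []       = refl
addZV₄-double (0F ∷ b) = cong (0F ∷_) (addZV₄-double b)
addZV₄-double (1F ∷ b) = cong (3F ∷_) (addZV₄-double b)
addZV₄-double (2F ∷ b) = cong (2F ∷_) (addZV₄-double b)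
addZV₄-double (3F ∷ b) = cong (1F ∷_) (addZV₄-double b)

addZV₄-neg : ∀ {n} (b : ZV 4 n) → addZV 4 b (neg b) ≡ 0₄
addZV₄-neg []       = refl
addZV₄-neg (0F ∷ b) = cong (0F ∷_) (addZV₄-neg b)
addZV₄-neg (1F ∷ b) = cong (0F ∷_) (addZV₄-neg b)
addZV₄-neg (2F ∷ b) = cong (0F ∷_) (addZV₄-neg b)
addZV₄-neg (3F ∷ b) = cong (0F ∷_) (addZV₄-neg b)

-- Enumeration of the group

unique-concatMap : ∀ {I A : Set} (f : I → List A) {is} → Unique is → (∀ {i} → i ∈ is → Unique (f i)) →
  (∀ {i j x} → x ∈ f i → x ∈ f j → i ≡ j) → Unique (concatMap f is)
unique-concatMap f []                  uf inj = []
unique-concatMap f (_∷_ {x = i} {is} i∉ uq) uf inj =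
  Unique.++⁺ (uf (here refl)) (unique-concatMap f uq (uf ∘ there) inj) disjoint
  where
  disjoint : ∀ {x} → x ∈ f i × x ∈ concatMap f is → ⊥
  disjoint (p , q) with j , j∈ , x∈fj ← find (∈-concatMap⁻ f q) = All.lookup i∉ j∈ (inj p x∈fj)

allZV-unique : ∀ k n → Unique (allZV k n)
allZV-unique k zero    = [] ∷ []
allZV-unique k (suc n) = unique-concatMap (λ a → map (a ∷_) (allZV k n)) (Unique.allFin⁺ k)
  (λ _ → Unique.map⁺ Vec.∷-injectiveʳ (allZV-unique k n)) inj
  where
  inj : ∀ {i j : Fin k} {x} → x ∈ map (i ∷_) (allZV k n) → x ∈ map (j ∷_) (allZV k n) → i ≡ j
  inj p q with _ , _ , refl ← ∈-map⁻ _ p | _ , _ , eq ← ∈-map⁻ _ q = Vec.∷-injectiveˡ eq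

∈-allZV : ∀ k {n} (a : ZV k n) → a ∈ allZV k n
∈-allZV k []      = here refl
∈-allZV k (i ∷ a) = ∈-concatMap⁺ _ (lose (∈-allFin i) (∈-map⁺ (i ∷_) (∈-allZV k a)))

length-concatMap : ∀ {I A : Set} (f : I → List A) is {m} → (∀ {i} → i ∈ is → length (f i) ≡ m) →
  length (concatMap f is) ≡ length is ℕ.* m
length-concatMap f []       eq = refl
length-concatMap f (i ∷ is) eq = trans (length-++ (f i)) (cong₂ ℕ._+_ (eq (here refl)) (length-concatMap f is (eq ∘ there)))

length-allZV : ∀ k n → length (allZV k n) ≡ k ℕ.^ n
length-allZV k zero    = refl
length-allZV k (suc n) = trans (length-concatMap _ (allFin k) {k ℕ.^ n} (λ {i} _ → trans (length-map _ (allZV k n)) (length-allZV k n)))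
  (cong (ℕ._* (k ℕ.^ n)) {y = k} (length-tabulate id))

length-product : ∀ {A B : Set} (xs : List A) (ys : List B) → length (cartesianProduct xs ys) ≡ length xs ℕ.* length ys
length-product []       ys = refl
length-product (x ∷ xs) ys = trans (length-++ (map (x ,_) ys)) (cong₂ ℕ._+_ (length-map (x ,_) ys) (length-product xs ys))

-- The enumeration begins with the zero vector (`allZV-nonzero`), so dropping the head removes
-- exactly that one.
nonzero : ∀ n → List (ZV 2 n)
nonzero n = drop 1 (allZV 2 n)

allZV-nonzero : ∀ n → allZV 2 n ≡ 0₂ ∷ nonzero n
allZV-nonzero zero    = refl
allZV-nonzero (suc n) rewrite allZV-nonzero n = refl

nonzero-unique : ∀ n → Unique (nonzero n)
nonzero-unique n = Unique.drop⁺ 1 (allZV-unique 2 n)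

∈-nonzero⁻ : ∀ {n} {a : ZV 2 n} → a ∈ nonzero n → a ≢ 0₂
∈-nonzero⁻ {n} a∈ refl = Unique.Unique[x∷xs]⇒x∉xs (subst Unique (allZV-nonzero n) (allZV-unique 2 n)) a∈

∈-nonzero⁺ : ∀ {n} {a : ZV 2 n} → a ≢ 0₂ → a ∈ nonzero n
∈-nonzero⁺ {n} {a} a≢0 with subst (a ∈_) (allZV-nonzero n) (∈-allZV 2 a)
... | here a≡0 = contradiction a≡0 a≢0
... | there a∈ = a∈

length-nonzero : ∀ n → 2 ℕ.^ n ≡ suc (length (nonzero n))
length-nonzero n = trans (sym (length-allZV 2 n)) (cong length (allZV-nonzero n))

lifts : ∀ {n} → ZV 2 n → List (ZV 4 n)
lifts []       = [] ∷ []
lifts (0F ∷ l) = map (0F ∷_) (lifts l) ++ map (2F ∷_) (lifts l)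
lifts (1F ∷ l) = map (1F ∷_) (lifts l) ++ map (3F ∷_) (lifts l)

-- One lift from each pair `b`, `neg b`. Negation is used up by making the first odd entry 1, after
-- which all lifts of the tail are allowed. For `l = 0₂` the list is empty: there every lift is its
-- own negative.
canonLifts : ∀ {n} → ZV 2 n → List (ZV 4 n)
canonLifts []       = []
canonLifts (0F ∷ l) = map (0F ∷_) (canonLifts l) ++ map (2F ∷_) (canonLifts l)
canonLifts (1F ∷ l) = map (1F ∷_) (lifts l)

∈-lifts⁺ : ∀ {n} (b : ZV 4 n) → b ∈ lifts (lowBits b)
∈-lifts⁺ []       = here refl
∈-lifts⁺ (0F ∷ b) = ∈-++⁺ˡ (∈-map⁺ (0F ∷_) (∈-lifts⁺ b))
∈-lifts⁺ (1F ∷ b) = ∈-++⁺ˡ (∈-map⁺ (1F ∷_) (∈-lifts⁺ b))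
∈-lifts⁺ (2F ∷ b) = ∈-++⁺ʳ (map (0F ∷_) (lifts (lowBits b))) (∈-map⁺ (2F ∷_) (∈-lifts⁺ b))
∈-lifts⁺ (3F ∷ b) = ∈-++⁺ʳ (map (1F ∷_) (lifts (lowBits b))) (∈-map⁺ (3F ∷_) (∈-lifts⁺ b))

∈-canonLifts⁺ : ∀ {n} (b : ZV 4 n) → lowBits b ≢ 0₂ → canon b ∈ canonLifts (lowBits b)
∈-canonLifts⁺ []       l≢0 = contradiction refl l≢0
∈-canonLifts⁺ (0F ∷ b) l≢0 = ∈-++⁺ˡ (∈-map⁺ (0F ∷_) (∈-canonLifts⁺ b (l≢0 ∘ cong (0F ∷_))))
∈-canonLifts⁺ (2F ∷ b) l≢0 = ∈-++⁺ʳ (map (0F ∷_) (canonLifts (lowBits b))) (∈-map⁺ (2F ∷_) (∈-canonLifts⁺ b (l≢0 ∘ cong (0F ∷_))))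
∈-canonLifts⁺ (1F ∷ b) l≢0 = ∈-map⁺ (1F ∷_) (∈-lifts⁺ b)
∈-canonLifts⁺ (3F ∷ b) l≢0 = ∈-map⁺ (1F ∷_) (subst (λ l → neg b ∈ lifts l) (lowBits-neg b) (∈-lifts⁺ (neg b)))

∈-map-++⁻ : ∀ {A B : Set} (f g : A → B) xs ys {y} → y ∈ map f xs ++ map g ys →
  (∃ λ x → x ∈ xs × y ≡ f x) ⊎ (∃ λ x → x ∈ ys × y ≡ g x)
∈-map-++⁻ f g xs ys y∈ with ∈-++⁻ (map f xs) y∈
... | inj₁ p = inj₁ (∈-map⁻ f p)
... | inj₂ p = inj₂ (∈-map⁻ g p)

∈-lifts⁻ : ∀ {n} (l : ZV 2 n) {b} → b ∈ lifts l → lowBits b ≡ l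
∈-lifts⁻ []       (here refl) = refl
∈-lifts⁻ (0F ∷ l) b∈ with ∈-map-++⁻ (0F ∷_) (2F ∷_) (lifts l) (lifts l) b∈
... | inj₁ (_ , p , refl) = cong (0F ∷_) (∈-lifts⁻ l p)
... | inj₂ (_ , p , refl) = cong (0F ∷_) (∈-lifts⁻ l p)
∈-lifts⁻ (1F ∷ l) b∈ with ∈-map-++⁻ (1F ∷_) (3F ∷_) (lifts l) (lifts l) b∈
... | inj₁ (_ , p , refl) = cong (1F ∷_) (∈-lifts⁻ l p)
... | inj₂ (_ , p , refl) = cong (1F ∷_) (∈-lifts⁻ l p)

∈-canonLifts⁻ : ∀ {n} (l : ZV 2 n) {b} → b ∈ canonLifts l → lowBits b ≡ l × canon b ≡ b
∈-canonLifts⁻ (0F ∷ l) b∈ with ∈-map-++⁻ (0F ∷_) (2F ∷_) (canonLifts l) (canonLifts l) b∈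
... | inj₁ (_ , p , refl) = let q , q′ = ∈-canonLifts⁻ l p in cong (0F ∷_) q , cong (0F ∷_) q′
... | inj₂ (_ , p , refl) = let q , q′ = ∈-canonLifts⁻ l p in cong (0F ∷_) q , cong (2F ∷_) q′
∈-canonLifts⁻ (1F ∷ l) b∈ with _ , p , refl ← ∈-map⁻ (1F ∷_) b∈ = cong (1F ∷_) (∈-lifts⁻ l p) , refl

unique-map-++ : ∀ {n} {i j : Fin 4} {xs ys : List (ZV 4 n)} → i ≢ j → Unique xs → Unique ys →
  Unique (map (i ∷_) xs ++ map (j ∷_) ys)
unique-map-++ {i = i} {j} {xs} {ys} i≢j ux uy = Unique.++⁺ (Unique.map⁺ Vec.∷-injectiveʳ ux) (Unique.map⁺ Vec.∷-injectiveʳ uy) disjoint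
  where
  disjoint : ∀ {b} → b ∈ map (i ∷_) xs × b ∈ map (j ∷_) ys → ⊥
  disjoint (p , q) with _ , _ , refl ← ∈-map⁻ _ p | _ , _ , eq ← ∈-map⁻ _ q = i≢j (Vec.∷-injectiveˡ eq)

lifts-unique : ∀ {n} (l : ZV 2 n) → Unique (lifts l)
lifts-unique []       = [] ∷ []
lifts-unique (0F ∷ l) = unique-map-++ (λ ()) (lifts-unique l) (lifts-unique l)
lifts-unique (1F ∷ l) = unique-map-++ (λ ()) (lifts-unique l) (lifts-unique l)

canonLifts-unique : ∀ {n} (l : ZV 2 n) → Unique (canonLifts l)
canonLifts-unique []       = []
canonLifts-unique (0F ∷ l) = unique-map-++ (λ ()) (canonLifts-unique l) (canonLifts-unique l)
canonLifts-unique (1F ∷ l) = Unique.map⁺ Vec.∷-injectiveʳ (lifts-unique l)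

length-map-++ : ∀ {A B : Set} (f g : A → B) xs {m} → length xs ≡ m → length (map f xs ++ map g xs) ≡ 2 ℕ.* m
length-map-++ f g xs refl = trans (length-++ (map f xs)) (cong₂ ℕ._+_ (length-map f xs) (trans (length-map g xs) (sym (ℕ.+-identityʳ _))))

length-lifts : ∀ {n} (l : ZV 2 n) → length (lifts l) ≡ 2 ℕ.^ n
length-lifts []       = refl
length-lifts (0F ∷ l) = length-map-++ _ _ (lifts l) (length-lifts l)
length-lifts (1F ∷ l) = length-map-++ _ _ (lifts l) (length-lifts l)

length-canonLifts : ∀ {n} (l : ZV 2 (suc n)) → l ≢ 0₂ → length (canonLifts l) ≡ 2 ℕ.^ n
length-canonLifts         (1F ∷ l) l≢0 = trans (length-map _ (lifts l)) (length-lifts l)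
length-canonLifts {zero}  (0F ∷ []) l≢0 = contradiction refl l≢0
length-canonLifts {suc n} (0F ∷ l) l≢0 = length-map-++ _ _ (canonLifts l) (length-canonLifts l (l≢0 ∘ cong (0F ∷_)))

-- A pigeonhole argument that reduces the comparison of `elems` with `arranged` to membership and a
-- count; that `arranged` has no repetitions comes out as a consequence.
⊆∧length⇒↭ : ∀ {A : Set} {xs ys : List A} → Unique xs → (∀ {x} → x ∈ xs → x ∈ ys) →
  length xs ≡ length ys → xs ↭ ys
⊆∧length⇒↭ {ys = []}     []        _     _  = ↭-refl
⊆∧length⇒↭ {xs = x ∷ xs} (x∉ ∷ uq) xs⊆ys len with as , bs , refl ← ∈-∃++ (xs⊆ys (here refl)) =
  ↭-trans (prep x (⊆∧length⇒↭ uq sub (ℕ.suc-injective (trans len (↭.↭-length (↭.shift x as bs)))))) (↭-sym (↭.shift x as bs))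
  where
  sub : ∀ {y} → y ∈ xs → y ∈ as ++ bs
  sub y∈ with ↭.∈-resp-↭ (↭.shift x as bs) (xs⊆ys (there y∈))
  ... | here refl = contradiction refl (All.lookup x∉ y∈)
  ... | there p   = p

module _ (r s : ℕ) where

  elems-unique : Unique (elems r s)
  elems-unique = Unique.cartesianProduct⁺ (allZV-unique 2 r) (allZV-unique 4 s)

  ∈-elems : (x : G r s) → x ∈ elems r s
  ∈-elems (a , b) = ∈-cartesianProduct⁺ (∈-allZV 2 a) (∈-allZV 4 b)

  length-elems : length (elems r s) ≡ 2 ℕ.^ r ℕ.* 4 ℕ.^ s
  length-elems = trans (length-product (allZV 2 r) (allZV 4 s)) (cong₂ ℕ._*_ (length-allZV 2 r) (length-allZV 4 s))

-- Powers, adjacency, and components after removal of the identity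

module _ {r s : ℕ} where

  sq inv : G r s → G r s
  sq  (a , b) = 0₂ , double (lowBits b)
  inv (a , b) = a , neg b

  ·G-cong : ∀ (x : G r s) {y z w} → y ≡ z → x ·G z ≡ w → x ·G y ≡ w
  ·G-cong x refl eq = eq

  ·G-e : (x : G r s) → x ·G eG r s ≡ x
  ·G-e (a , b) = cong₂ _,_ (addZV₂-0 a) (addZV₄-0 b)

  ·G-self : (x : G r s) → x ·G x ≡ sq x
  ·G-self (a , b) = cong₂ _,_ (addZV₂-self a) (addZV₄-self b)

  ·G-sq : (x : G r s) → x ·G sq x ≡ inv x
  ·G-sq (a , b) = cong₂ _,_ (addZV₂-0 a) (addZV₄-double b)

  ·G-inv : (x : G r s) → x ·G inv x ≡ eG r s
  ·G-inv (a , b) = cong₂ _,_ (addZV₂-self a) (addZV₄-neg b)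

  -- The group has exponent 4, and multiplication by `x` cycles through the four cases.
  powG-cases : ∀ k (x : G r s) → (powG k x ≡ eG r s ⊎ powG k x ≡ x) ⊎ (powG k x ≡ sq x ⊎ powG k x ≡ inv x)
  powG-cases zero    x = inj₁ (inj₁ refl)
  powG-cases (suc k) x with powG-cases k x
  ... | inj₁ (inj₁ p) = inj₁ (inj₂ (·G-cong x p (·G-e x)))
  ... | inj₁ (inj₂ p) = inj₂ (inj₁ (·G-cong x p (·G-self x)))
  ... | inj₂ (inj₁ p) = inj₂ (inj₂ (·G-cong x p (·G-sq x)))
  ... | inj₂ (inj₂ p) = inj₁ (inj₁ (·G-cong x p (·G-inv x)))

  powG-2 : (x : G r s) → powG 2 x ≡ sq x
  powG-2 x = ·G-cong x (·G-e x) (·G-self x)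

  powG-3 : (x : G r s) → powG 3 x ≡ inv x
  powG-3 x = ·G-cong x (powG-2 x) (·G-sq x)

  isPowerOf⁺ : ∀ k (x y : G r s) → k ℕ.< order r s → powG k x ≡ y → isPowerOf y x ≡ true
  isPowerOf⁺ k x y k< refl = Equivalence.to T-≡
    (Any.any⁺ _ (lose (∈-upTo⁺ k<) (Equivalence.from T-≡ (eqG-refl (powG k x)))))

  isPowerOf⁻ : (x y : G r s) → y ≢ eG r s → y ≢ x → isPowerOf y x ≡ true → y ≡ sq x ⊎ y ≡ inv x
  isPowerOf⁻ x y y≢e y≢x eq with k , _ , p ← find (Any.any⁻ (λ k → eqG (powG k x) y) (upTo (order r s)) (Equivalence.from T-≡ eq))
    with refl ← eqG⇒≡ (powG k x) y (Equivalence.to T-≡ p) with powG-cases k x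
  ... | inj₁ (inj₁ q) = contradiction q y≢e
  ... | inj₁ (inj₂ q) = contradiction q y≢x
  ... | inj₂ q        = q

  adjP⁺ : ∀ k (x y : G r s) → k ℕ.< order r s → x ≢ y → powG k x ≡ y → adjP x y ≡ true
  adjP⁺ k x y k< x≢y eq rewrite ≢⇒eqG x y x≢y | isPowerOf⁺ k x y k< eq = refl

  adjP⁻ : (x y : G r s) → x ≢ eG r s → y ≢ eG r s → adjP x y ≡ true →
          (y ≡ sq x ⊎ y ≡ inv x) ⊎ (x ≡ sq y ⊎ x ≡ inv y)
  adjP⁻ x y x≢e y≢e adj with eqG x y in eq
  ... | false with ∨-true adj
  ...   | inj₁ p = inj₁ (isPowerOf⁻ x y y≢e y≢x p)
    where
    y≢x : y ≢ x
    y≢x refl with () ← trans (sym (eqG-refl x)) eq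
  ...   | inj₂ p = inj₂ (isPowerOf⁻ y x x≢e x≢y p)
    where
    x≢y : x ≢ y
    x≢y refl with () ← trans (sym (eqG-refl x)) eq

  adjP-false : (x y : G r s) → x ≢ eG r s → y ≢ eG r s →
               ¬ ((y ≡ sq x ⊎ y ≡ inv x) ⊎ (x ≡ sq y ⊎ x ≡ inv y)) → adjP x y ≡ false
  adjP-false x y x≢e y≢e ¬p with adjP x y in eq
  ... | true  = contradiction (adjP⁻ x y x≢e y≢e eq) ¬p
  ... | false = refl

  -- The involution in the subgroup generated by x, for x ≢ e.
  comp : G r s → G r s
  comp (a , b) with Vec.≡-dec Fin._≟_ (lowBits b) 0₂
  ... | yes _ = a , b
  ... | no  _ = sq (a , b)

  comp-even : ∀ a b → lowBits b ≡ 0₂ → comp (a , b) ≡ (a , b)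
  comp-even a b l≡0 with Vec.≡-dec Fin._≟_ (lowBits b) 0₂
  ... | yes _  = refl
  ... | no l≢0 = contradiction l≡0 l≢0

  comp-odd : ∀ a b → lowBits b ≢ 0₂ → comp (a , b) ≡ sq (a , b)
  comp-odd a b l≢0 with Vec.≡-dec Fin._≟_ (lowBits b) 0₂
  ... | yes l≡0 = contradiction l≡0 l≢0
  ... | no _    = refl

  comp-sq : ∀ x → sq x ≢ eG r s → comp (sq x) ≡ comp x
  comp-sq (a , b) sq≢e = trans (comp-even 0₂ (double (lowBits b)) (lowBits-double (lowBits b))) (sym (comp-odd a b l≢0))
    where
    l≢0 : lowBits b ≢ 0₂
    l≢0 eq = sq≢e (cong (0₂ ,_) (trans (cong double eq) (double-0 s)))

  comp-inv : ∀ x → comp (inv x) ≡ comp x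
  comp-inv (a , b) with Vec.≡-dec Fin._≟_ (lowBits b) 0₂
  ... | yes l≡0 with h , refl ← lowBits≡0⇒double b l≡0 = trans (cong (λ c → comp (a , c)) (neg-double h)) (comp-even a _ l≡0)
  ... | no  l≢0 = trans (comp-odd a (neg b) (l≢0 ∘ trans (sym (lowBits-neg b)))) (cong (λ l → 0₂ , double l) (lowBits-neg b))

  -- `comp` is constant along every edge that avoids the identity, so different values of `comp`
  -- certify a zero entry of the matrix.
  adjacent⇒comp : ∀ {x y} → x ≢ eG r s → y ≢ eG r s → (y ≡ sq x ⊎ y ≡ inv x) ⊎ (x ≡ sq y ⊎ x ≡ inv y) → comp x ≡ comp y
  adjacent⇒comp {x} {y} x≢e y≢e (inj₁ (inj₁ refl)) = sym (comp-sq x y≢e)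
  adjacent⇒comp {x} {y} x≢e y≢e (inj₁ (inj₂ refl)) = sym (comp-inv x)
  adjacent⇒comp {x} {y} x≢e y≢e (inj₂ (inj₁ refl)) = comp-sq y x≢e
  adjacent⇒comp {x} {y} x≢e y≢e (inj₂ (inj₂ refl)) = comp-inv y

  -- The group arranged along the tree

  involution : ZV 2 r × ZV 2 s → G r s
  involution (a , h) = a , double h

  pair : G r s → List (G r s)
  pair x = x ∷ inv x ∷ []

  -- One element from each inverse pair with square `(0₂ , double l)`. First coordinates are their
  -- own inverses, so only the second is normalised.
  reps : ZV 2 s → List (G r s)
  reps l = cartesianProduct (allZV 2 r) (canonLifts l)

  -- The square roots of `(0₂ , double l)`, grouped into inverse pairs.
  roots : ZV 2 s → List (G r s)
  roots l = concatMap pair (reps l)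

  star : ZV 2 s → List (G r s)
  star l = (0₂ , double l) ∷ roots l

  -- The involutions that are not squares, as squares have first coordinate zero. They are leaves
  -- directly below the identity.
  singles : List (ZV 2 r × ZV 2 s)
  singles = cartesianProduct (nonzero r) (allZV 2 s)

  nonidentity : List (G r s)
  nonidentity = concatMap (λ t → involution t ∷ []) singles ++ concatMap star (nonzero s)

  arranged : List (G r s)
  arranged = eG r s ∷ nonidentity

  ∈-reps⁻ : ∀ l {x} → x ∈ reps l → lowBits (proj₂ x) ≡ l × canon (proj₂ x) ≡ proj₂ x
  ∈-reps⁻ l x∈ = ∈-canonLifts⁻ l (proj₂ (∈-cartesianProduct⁻ (allZV 2 r) (canonLifts l) x∈))

  reps-unique : ∀ l → Unique (reps l)
  reps-unique l = Unique.cartesianProduct⁺ (allZV-unique 2 r) (canonLifts-unique l)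

  singles-unique : Unique singles
  singles-unique = Unique.cartesianProduct⁺ (nonzero-unique r) (allZV-unique 2 s)

  ∈-pair⁻ : ∀ {l x y} → x ∈ reps l → y ∈ pair x → lowBits (proj₂ y) ≡ l × (proj₁ y , canon (proj₂ y)) ≡ x
  ∈-pair⁻ {l} {a , b} x∈ (here refl)         = let p , q = ∈-reps⁻ l x∈ in p , cong (a ,_) q
  ∈-pair⁻ {l} {a , b} x∈ (there (here refl)) = let p , q = ∈-reps⁻ l x∈ in
    trans (lowBits-neg b) p , cong (a ,_) (trans (canon-neg b) q)

  ∈-roots⁻ : ∀ l {y} → y ∈ roots l → lowBits (proj₂ y) ≡ l
  ∈-roots⁻ l y∈ with x , x∈ , y∈x ← find (∈-concatMap⁻ pair y∈) = proj₁ (∈-pair⁻ {l} x∈ y∈x)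

  ∈-star⁻ : ∀ {l y} → l ≢ 0₂ → y ∈ star l → comp y ≡ (0₂ , double l)
  ∈-star⁻ {l} l≢0 (here refl) = comp-even 0₂ (double l) (lowBits-double l)
  ∈-star⁻ {l} {a , b} l≢0 (there y∈) with refl ← ∈-roots⁻ l y∈ = comp-odd a b l≢0

  ∈-arranged : ∀ x → x ∈ arranged
  ∈-arranged (a , b) with Vec.≡-dec Fin._≟_ (lowBits b) 0₂
  ... | no l≢0 = there (∈-++⁺ʳ (concatMap (λ t → involution t ∷ []) singles)
                   (∈-concatMap⁺ star (lose (∈-nonzero⁺ l≢0) (there (∈-concatMap⁺ pair (lose
                     (∈-cartesianProduct⁺ (∈-allZV 2 a) (∈-canonLifts⁺ b l≢0)) mem))))))
    where
    mem : (a , b) ∈ pair (a , canon b)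
    mem with canon-cases b
    ... | inj₁ p = here (cong (a ,_) p)
    ... | inj₂ p = there (here (cong (a ,_) p))
  ... | yes l≡0 with h , refl ← lowBits≡0⇒double b l≡0 with Vec.≡-dec Fin._≟_ a 0₂
  ...   | no a≢0 = there (∈-++⁺ˡ (∈-concatMap⁺ (λ t → involution t ∷ []) (lose (∈-cartesianProduct⁺ (∈-nonzero⁺ a≢0) (∈-allZV 2 h)) (here refl))))
  ...   | yes refl with Vec.≡-dec Fin._≟_ h 0₂
  ...     | yes refl = here (cong (0₂ ,_) (double-0 s))
  ...     | no h≢0   = there (∈-++⁺ʳ (concatMap (λ t → involution t ∷ []) singles)
                         (∈-concatMap⁺ star (lose (∈-nonzero⁺ h≢0) (here refl))))

-- Cardinalities

module _ {r s′ : ℕ} where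

  private
    s : ℕ
    s = suc s′

  length-reps : ∀ {l} → l ≢ 0₂ → length (reps {r} {s} l) ≡ 2 ℕ.^ r ℕ.* 2 ℕ.^ s′
  length-reps {l} l≢0 = trans (length-product (allZV 2 r) (canonLifts l)) (cong₂ ℕ._*_ (length-allZV 2 r) (length-canonLifts l l≢0))

  length-roots : ∀ {l} → l ≢ 0₂ → length (roots {r} {s} l) ≡ 2 ℕ.^ r ℕ.* 2 ℕ.^ s′ ℕ.* 2
  length-roots {l} l≢0 = trans (length-concatMap pair (reps {r} l) (λ _ → refl)) (cong (ℕ._* 2) (length-reps {l} l≢0))

  length-singles : length (singles {r} {s}) ≡ length (nonzero r) ℕ.* 2 ℕ.^ s
  length-singles = trans (length-product (nonzero r) (allZV 2 s)) (cong (length (nonzero r) ℕ.*_) (length-allZV 2 s))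

  length-arranged : length (elems r s) ≡ length (arranged {r} {s})
  length-arranged = begin
    length (elems r s)
      ≡⟨ length-elems r s ⟩
    2 ℕ.^ r ℕ.* 4 ℕ.^ s
      ≡⟨ cong (2 ℕ.^ r ℕ.*_) (ℕ.^-*-assoc 2 2 s) ⟩
    2 ℕ.^ r ℕ.* 2 ℕ.^ (2 ℕ.* s)
      ≡⟨ cong (λ e → 2 ℕ.^ r ℕ.* 2 ℕ.^ (s ℕ.+ e)) (ℕ.+-identityʳ s) ⟩
    2 ℕ.^ r ℕ.* 2 ℕ.^ (s ℕ.+ s)
      ≡⟨ cong (2 ℕ.^ r ℕ.*_) (ℕ.^-distribˡ-+-* 2 s s) ⟩
    2 ℕ.^ r ℕ.* (2 ℕ.^ s ℕ.* 2 ℕ.^ s)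
      ≡⟨ count (length (nonzero r)) (length (nonzero s)) (2 ℕ.^ r) (2 ℕ.^ s) (2 ℕ.^ s′) (length-nonzero r) (length-nonzero s) refl ⟩
    suc (length (nonzero r) ℕ.* 2 ℕ.^ s ℕ.* 1 ℕ.+ length (nonzero s) ℕ.* suc (2 ℕ.^ r ℕ.* 2 ℕ.^ s′ ℕ.* 2))
      ≡⟨ cong suc (cong₂ ℕ._+_ lengthₗ lengthᵣ) ⟨
    suc (length (concatMap (λ t → involution t ∷ []) (singles {r} {s})) ℕ.+ length (concatMap (star {r}) (nonzero s)))
      ≡⟨ cong suc (length-++ (concatMap (λ t → involution t ∷ []) (singles {r} {s}))) ⟨
    length (arranged {r} {s}) ∎
    where
    lengthₗ : length (concatMap (λ t → involution t ∷ []) (singles {r} {s})) ≡ length (nonzero r) ℕ.* 2 ℕ.^ s ℕ.* 1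
    lengthₗ = trans (length-concatMap (λ t → involution t ∷ []) (singles {r} {s}) (λ _ → refl)) (cong (ℕ._* 1) length-singles)
    lengthᵣ : length (concatMap (star {r}) (nonzero s)) ≡ length (nonzero s) ℕ.* suc (2 ℕ.^ r ℕ.* 2 ℕ.^ s′ ℕ.* 2)
    lengthᵣ = length-concatMap star (nonzero s) (λ l∈ → cong suc (length-roots (∈-nonzero⁻ l∈)))
    -- The powers of 2 become variables, so that `R = 1 + p` and `S = 1 + q` can be substituted.
    -- What remains is a polynomial identity: identity element, `p * S` non-square involutions, and
    -- `q` stars of `1 + R * S` vertices.
    count : ∀ p q R S S′ → R ≡ suc p → S ≡ suc q → S ≡ 2 ℕ.* S′ →
            R ℕ.* (S ℕ.* S) ≡ suc (p ℕ.* S ℕ.* 1 ℕ.+ q ℕ.* suc (R ℕ.* S′ ℕ.* 2))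
    count p q R S S′ refl refl eq = begin
      suc p ℕ.* (suc q ℕ.* suc q)                                   ≡⟨ expand p q ⟩
      suc (p ℕ.* suc q ℕ.* 1 ℕ.+ q ℕ.* suc (suc p ℕ.* suc q))       ≡⟨ cong (λ t → suc (p ℕ.* suc q ℕ.* 1 ℕ.+ q ℕ.* suc (suc p ℕ.* t))) (trans eq (ℕ.*-comm 2 S′)) ⟩
      suc (p ℕ.* suc q ℕ.* 1 ℕ.+ q ℕ.* suc (suc p ℕ.* (S′ ℕ.* 2)))  ≡⟨ cong (λ t → suc (p ℕ.* suc q ℕ.* 1 ℕ.+ q ℕ.* suc t)) (ℕ.*-assoc (suc p) S′ 2) ⟨
      suc (p ℕ.* suc q ℕ.* 1 ℕ.+ q ℕ.* suc (suc p ℕ.* S′ ℕ.* 2))    ∎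
      where
      expand : ∀ p q → (1 ℕ.+ p) ℕ.* ((1 ℕ.+ q) ℕ.* (1 ℕ.+ q)) ≡ 1 ℕ.+ (p ℕ.* (1 ℕ.+ q) ℕ.* 1 ℕ.+ q ℕ.* (1 ℕ.+ (1 ℕ.+ p) ℕ.* (1 ℕ.+ q)))
      expand = solve-∀ᴺ

  elems↭arranged : elems r s ↭ arranged
  elems↭arranged = ⊆∧length⇒↭ (elems-unique r s) (λ _ → ∈-arranged _) length-arranged

-- The characteristic matrix of the power graph

lookup-injective : ∀ {A : Set} {xs : List A} → Unique xs → ∀ i j → lookup xs i ≡ lookup xs j → i ≡ j
lookup-injective (x∉ ∷ uq) Fin.zero    Fin.zero    _  = refl
lookup-injective {xs = x ∷ xs} (x∉ ∷ uq) Fin.zero (Fin.suc j) eq = contradiction eq (All.lookup x∉ (∈-lookup j))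
lookup-injective {xs = x ∷ xs} (x∉ ∷ uq) (Fin.suc i) Fin.zero eq = contradiction (sym eq) (All.lookup x∉ (∈-lookup i))
lookup-injective (x∉ ∷ uq) (Fin.suc i) (Fin.suc j) eq = cong Fin.suc (lookup-injective uq i j eq)

sumFin-lookup : ∀ {A : Set} (xs : List A) (g : A → ℤ) → sumFin (length xs) (g ∘ lookup xs) ≡ ∑ xs g
sumFin-lookup xs g = trans (go (length xs) id) (cong (λ l → ∑ l g) (tabulate-lookup xs))
  where
  go : ∀ m (h : Fin m → Fin (length xs)) →
       foldr (λ i acc → g (lookup xs i) + acc) (+ 0) (tabulate h) ≡ ∑ (tabulate (lookup xs ∘ h)) g
  go zero    h = refl
  go (suc m) h = cong (_+_ (g (lookup xs (h Fin.zero)))) (go m (h ∘ Fin.suc))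

∑-indicator : ∀ {r s xs} {w : G r s} c → Unique xs → w ∈ xs → ∑ xs (λ u → if eqG w u then c else + 0) ≡ c
∑-indicator {xs = u ∷ xs} {w} c (w∉ ∷ uq) (here refl) rewrite eqG-refl w =
  trans (cong (_+_ c) (∑-zero xs (λ {v} v∈ → cong (λ b → if b then c else + 0) (≢⇒eqG w v (All.lookup w∉ v∈))))) (+-identityʳ c)
∑-indicator {xs = u ∷ xs} {w} c (u∉ ∷ uq) (there w∈) rewrite ≢⇒eqG w u (All.lookup u∉ w∈ ∘ sym) =
  trans (+-identityˡ _) (∑-indicator c uq w∈)

module CharacteristicMatrix (r s : ℕ) (x : ℤ) where

  deg : G r s → ℤ
  deg u = ∑ (elems r s) (λ w → b2ℤ (adjP u w))

  -- This is (xI - D) + A, hence +1 for an edge. The adjacency term is kept on the diagonal too,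
  -- where it is 0, so that summing it over a whole row gives exactly `deg`.
  entry : G r s → G r s → ℤ
  entry u v = (if eqG u v then x - deg u else + 0) + b2ℤ (adjP u v)

  open Submatrix entry public

  entry-sym : ∀ u v → entry u v ≡ entry v u
  entry-sym u v = cong₂ _+_ (trans same (cong (λ b → if b then x - deg v else + 0) (eqG-sym u v))) (cong b2ℤ (adjP-sym u v))
    where
    same : (if eqG u v then x - deg u else + 0) ≡ (if eqG u v then x - deg v else + 0)
    same with eqG u v in eq
    ... | true  = cong (λ w → x - deg w) (eqG⇒≡ u v eq)
    ... | false = refl

  entry-≢ : ∀ {u v b} → u ≢ v → adjP u v ≡ b → entry u v ≡ b2ℤ b
  entry-≢ {u} {v} u≢v adj = trans
    (cong₂ (λ b c → (if b then x - deg u else + 0) + b2ℤ c) (≢⇒eqG u v u≢v) adj) (+-identityˡ _)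

  -- Symmetry turns the column into a row, whose adjacency terms add up to the degree subtracted on
  -- the diagonal.
  columnSum : ColSum (elems r s) x
  columnSum {w} _ = begin
    ∑ (elems r s) (λ u → entry u w)
      ≡⟨ ∑-cong (elems r s) (λ {u} _ → entry-sym u w) ⟩
    ∑ (elems r s) (entry w)
      ≡⟨ ∑-+ (elems r s) (λ u → if eqG w u then x - deg w else + 0) (λ u → b2ℤ (adjP w u)) ⟩
    ∑ (elems r s) (λ u → if eqG w u then x - deg w else + 0) + deg w
      ≡⟨ cong (_+ deg w) (∑-indicator (x - deg w) (elems-unique r s) (∈-elems r s w)) ⟩
    x - deg w + deg w
      ≡⟨ lemma x (deg w) ⟩
    x ∎
    where
    lemma : ∀ a b → a - b + b ≡ a
    lemma = solve-∀

  eval-entry : ∀ i j → eval x ((if ⌊ i Fin.≟ j ⌋ then X else []) ⊖ const (Lap r s i j)) ≡ entry (vtx r s i) (vtx r s j)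
  eval-entry i j = begin
    eval x ((if ⌊ i Fin.≟ j ⌋ then X else []) ⊖ const (Lap r s i j))
      ≡⟨ eval-⊖ x (if ⌊ i Fin.≟ j ⌋ then X else []) (const (Lap r s i j)) ⟩
    eval x (if ⌊ i Fin.≟ j ⌋ then X else []) - eval x (const (Lap r s i j))
      ≡⟨ cong (_-_ (eval x (if ⌊ i Fin.≟ j ⌋ then X else []))) (eval-const x (Lap r s i j)) ⟩
    eval x (if ⌊ i Fin.≟ j ⌋ then X else []) - Lap r s i j
      ≡⟨ cases ⟩
    entry (vtx r s i) (vtx r s j) ∎
    where
    diagonal : ∀ x d a → x - (d - a) ≡ x - d + a
    diagonal = solve-∀
    offDiagonal : ∀ a → + 0 - (+ 0 - a) ≡ + 0 + a
    offDiagonal = solve-∀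
    cases : eval x (if ⌊ i Fin.≟ j ⌋ then X else []) - Lap r s i j ≡ entry (vtx r s i) (vtx r s j)
    cases with i Fin.≟ j
    ... | yes refl = begin
      eval x X - (Deg r s i - Adj r s i i)
        ≡⟨ cong₂ (λ a d → a - (d - Adj r s i i)) (eval-X x) (sumFin-lookup (elems r s) (λ w → b2ℤ (adjP (vtx r s i) w))) ⟩
      x - (deg (vtx r s i) - Adj r s i i)
        ≡⟨ diagonal x (deg (vtx r s i)) (Adj r s i i) ⟩
      x - deg (vtx r s i) + Adj r s i i
        ≡⟨ cong (λ b → (if b then x - deg (vtx r s i) else + 0) + Adj r s i i) (eqG-refl (vtx r s i)) ⟨
      entry (vtx r s i) (vtx r s i) ∎
    ... | no i≢j = trans (offDiagonal (Adj r s i j))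
      (cong (λ b → (if b then x - deg (vtx r s i) else + 0) + Adj r s i j)
            (sym (≢⇒eqG (vtx r s i) (vtx r s j) (i≢j ∘ lookup-injective (elems-unique r s) i j))))

  eval-laplacianPoly : eval x (laplacianPoly r s) ≡ D (elems r s)
  eval-laplacianPoly = begin
    eval x (laplacianPoly r s)
      ≡⟨ eval-det x (order r s) (λ i j → (if ⌊ i Fin.≟ j ⌋ then X else []) ⊖ const (Lap r s i j)) ⟩
    detF (order r s) (λ i j → eval x ((if ⌊ i Fin.≟ j ⌋ then X else []) ⊖ const (Lap r s i j)))
      ≡⟨ detF-cong (order r s) eval-entry ⟩
    detF (order r s) (λ i j → entry (vtx r s i) (vtx r s j))
      ≡⟨ detF-tabulate (order r s) (entry ∘ vtx r s) (vtx r s) ⟩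
    detL (tabulate (entry ∘ vtx r s)) (tabulate (vtx r s))
      ≡⟨ cong₂ detL (map-tabulate (vtx r s) entry) refl ⟨
    detL (map entry (tabulate (vtx r s))) (tabulate (vtx r s))
      ≡⟨ cong D (tabulate-lookup (elems r s)) ⟩
    D (elems r s) ∎

-- The determinant along the tree and the claimed factors

^-distribʳ-* : ∀ a b n → (a * b) ^ n ≡ a ^ n * b ^ n
^-distribʳ-* a b zero    = refl
^-distribʳ-* a b (suc n) = trans (cong (a * b *_) (^-distribʳ-* a b n)) (lemma a b (a ^ n) (b ^ n))
  where
  lemma : ∀ a b c d → a * b * (c * d) ≡ a * c * (b * d)
  lemma = solve-∀

-- The three nonzero numbers are the multipliers t - 1 of the cone identity at depths 0, 1 and 2,
-- each to be cancelled. Below, `m` is the number of inverse pairs in a star, `q` the number of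
-- stars, and `p` the number of nonzero first coordinates.
module Computation (r s′ : ℕ) (x : ℤ)
  {{_ : NonZero (x - + 1)}} {{_ : NonZero (x - + 1 - + 1)}} {{_ : NonZero (x - + 1 - + 1 - + 1)}} where

  s m p q : ℕ
  s = suc s′
  m = 2 ℕ.^ r ℕ.* 2 ℕ.^ s′
  p = length (nonzero r)
  q = length (nonzero s)

  open CharacteristicMatrix r s x

  e : G r s
  e = eG r s

  order≡ : order r s ≡ 2 ℕ.^ (r ℕ.+ 2 ℕ.* s)
  order≡ = trans (length-elems r s) (trans (cong (2 ℕ.^ r ℕ.*_) (ℕ.^-*-assoc 2 2 s)) (sym (ℕ.^-distribˡ-+-* 2 r (2 ℕ.* s))))

  -- `isPowerOf` searches only exponents below the order, and 3, the exponent that yields the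
  -- inverse, has to be among them.
  3<order : 3 ℕ.< order r s
  3<order = subst (3 ℕ.<_) (sym (length-elems r s)) (ℕ.*-mono-≤ (ℕ.m^n>0 2 r) (ℕ.*-monoʳ-≤ 4 (ℕ.m^n>0 4 s′)))

  entry-adj : ∀ k {u v} → k ℕ.≤ 3 → u ≢ v → powG k u ≡ v → entry u v ≡ + 1
  entry-adj k {u} {v} k≤3 u≢v eq = entry-≢ u≢v (adjP⁺ k u v (ℕ.≤-<-trans k≤3 3<order) u≢v eq)

  entry-comp : ∀ {u v} → u ≢ e → v ≢ e → comp u ≢ comp v → entry u v ≡ + 0
  entry-comp {u} {v} u≢e v≢e cu≢cv = entry-≢ (cu≢cv ∘ cong comp) (adjP-false u v u≢e v≢e (cu≢cv ∘ adjacent⇒comp u≢e v≢e))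

  double≢0 : ∀ {l : ZV 2 s} → l ≢ 0₂ → double l ≢ 0₄
  double≢0 l≢0 eq = l≢0 (double-injective (trans eq (sym (double-0 s))))

  lowBits-e : lowBits (0₄ {s}) ≡ 0₂
  lowBits-e = trans (cong lowBits (sym (double-0 s))) (lowBits-double {s} 0₂)

  comp-e : comp e ≡ e
  comp-e = comp-even 0₂ 0₄ lowBits-e

  lowBits≢0⇒≢e : {u : G r s} → lowBits (proj₂ u) ≢ 0₂ → u ≢ e
  lowBits≢0⇒≢e l≢0 refl = l≢0 lowBits-e

  -- All elements of a star share the same `comp`, so a finer invariant is used. Elements with
  -- nonzero `lowBits` are not squares, which leaves inversion as the only source of an edge, and
  -- inversion preserves `key`.
  pairs-zero : ∀ {l} → l ≢ 0₂ → ∀ {y z} → y ∈ reps l → z ∈ reps l → y ≢ z → Zero (pair y) (pair z)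
  pairs-zero {l} l≢0 {y} {z} y∈ z∈ y≢z {u} {v} u∈ v∈ =
    entry-≢ (y≢z ∘ keys ∘ cong key) (adjP-false u v (lowBits≢0⇒≢e (l≢0 ∘ trans (sym lu))) (lowBits≢0⇒≢e (l≢0 ∘ trans (sym lv))) apart)
    where
    key : G r s → G r s
    key (a , b) = a , canon b
    lu : lowBits (proj₂ u) ≡ l
    lu = proj₁ (∈-pair⁻ {l = l} y∈ u∈)
    lv : lowBits (proj₂ v) ≡ l
    lv = proj₁ (∈-pair⁻ {l = l} z∈ v∈)
    keys : key u ≡ key v → y ≡ z
    keys eq = trans (sym (proj₂ (∈-pair⁻ {l = l} y∈ u∈))) (trans eq (proj₂ (∈-pair⁻ {l = l} z∈ v∈)))
    key-inv : ∀ w → key (inv w) ≡ key w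
    key-inv (a , b) = cong (a ,_) (canon-neg b)
    apart : ¬ ((v ≡ sq u ⊎ v ≡ inv u) ⊎ (u ≡ sq v ⊎ u ≡ inv v))
    apart (inj₁ (inj₁ refl)) = l≢0 (trans (sym lv) (lowBits-double (lowBits (proj₂ u))))
    apart (inj₁ (inj₂ refl)) = y≢z (keys (sym (key-inv u)))
    apart (inj₂ (inj₁ refl)) = l≢0 (trans (sym lu) (lowBits-double (lowBits (proj₂ v))))
    apart (inj₂ (inj₂ refl)) = y≢z (keys (key-inv v))

  -- The single vertex left under `z` has determinant `y - + 1`, its column sum, which is exactly
  -- the multiplier to be cancelled.
  D-pair : ∀ {l} → l ≢ 0₂ → ∀ {z} → z ∈ reps l → ColSum (pair z) (x - + 1 - + 1) →
           D (pair z) ≡ (x - + 1 - + 1) * (x - + 1 - + 1 - + 2)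
  D-pair {l} l≢0 {z} z∈ sums = *-cancelˡ-≡ (y - + 1) _ _ (begin
    (y - + 1) * D (pair z)             ≡⟨ D-cone z (inv z ∷ []) adj adj′ sums ⟩
    y * (y - + 2) * D (inv z ∷ [])     ≡⟨ cong (y * (y - + 2) *_) (D-[] (inv z) (ColSum-tail z (inv z ∷ []) adj sums)) ⟩
    y * (y - + 2) * (y - + 1)          ≡⟨ *-comm (y * (y - + 2)) (y - + 1) ⟩
    (y - + 1) * (y * (y - + 2))        ∎)
    where
    y : ℤ
    y = x - + 1 - + 1
    z≢ : z ≢ inv z
    z≢ eq = l≢0 (trans (sym (proj₁ (∈-reps⁻ l z∈))) (neg≡⇒lowBits≡0 (proj₂ z) (cong proj₂ (sym eq))))
    adj : ∀ {u} → u ∈ inv z ∷ [] → entry z u ≡ + 1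
    adj (here refl) = entry-adj 3 ℕ.≤-refl z≢ (powG-3 z)
    adj′ : ∀ {u} → u ∈ inv z ∷ [] → entry u z ≡ + 1
    adj′ {u} u∈ = trans (entry-sym u z) (adj u∈)

  -- The argument `m′` is m - 1: the `m` pairs contribute `m` factors x - 2, and one of them cancels
  -- against the multiplier at the top of the star.
  starDet : ℕ → ℤ
  starDet m′ = (x - + 1) * ((x - + 1 - + suc (m ℕ.* 2)) * ((x - + 1 - + 1) ^ m′ * (x - + 1 - + 1 - + 2) ^ m))

  D-star : ∀ {m′} → m ≡ suc m′ → ∀ {l} → l ≢ 0₂ → ColSum (star l) (x - + 1) → D (star l) ≡ starDet m′
  D-star {m′} m≡ {l} l≢0 sums = *-cancelˡ-≡ z _ _ (begin
    z * D (star l)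
      ≡⟨ D-cone (0₂ , double l) (roots l) adj adj′ sums ⟩
    y * (y - + suc (length (roots {r} l))) * D (roots l)
      ≡⟨ cong₂ (λ n d → y * (y - + suc n) * d) (length-roots {r} l≢0)
          (D-concatMap pair (reps l) (reps-unique l) (pairs-zero l≢0) (ColSum-tail (0₂ , double l) (roots l) adj sums) (D-pair l≢0)) ⟩
    y * (y - + suc (m ℕ.* 2)) * (z * (z - + 2)) ^ length (reps {r} l)
      ≡⟨ cong (λ n → y * (y - + suc (m ℕ.* 2)) * (z * (z - + 2)) ^ n) (length-reps {r} {s′} {l} l≢0) ⟩
    y * (y - + suc (m ℕ.* 2)) * (z * (z - + 2)) ^ m
      ≡⟨ cong (y * (y - + suc (m ℕ.* 2)) *_) (^-distribʳ-* z (z - + 2) m) ⟩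
    y * (y - + suc (m ℕ.* 2)) * (z ^ m * (z - + 2) ^ m)
      ≡⟨ cong (λ n → y * (y - + suc (m ℕ.* 2)) * (z ^ n * (z - + 2) ^ m)) m≡ ⟩
    y * (y - + suc (m ℕ.* 2)) * (z * z ^ m′ * (z - + 2) ^ m)
      ≡⟨ lemma y (y - + suc (m ℕ.* 2)) z (z ^ m′) ((z - + 2) ^ m) ⟩
    z * (y * ((y - + suc (m ℕ.* 2)) * (z ^ m′ * (z - + 2) ^ m))) ∎)
    where
    y z : ℤ
    y = x - + 1
    z = x - + 1 - + 1
    lemma : ∀ a b c d f → a * b * (c * d * f) ≡ c * (a * (b * (d * f)))
    lemma = solve-∀
    adj′ : ∀ {u} → u ∈ roots l → entry u (0₂ , double l) ≡ + 1
    adj′ {u} u∈ = entry-adj 2 (s≤s (s≤s z≤n)) u≢ (trans (powG-2 u) (cong (λ k → 0₂ , double k) lu))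
      where
      lu : lowBits (proj₂ u) ≡ l
      lu = ∈-roots⁻ l u∈
      u≢ : u ≢ (0₂ , double l)
      u≢ refl = l≢0 (trans (sym lu) (lowBits-double l))
    adj : ∀ {u} → u ∈ roots l → entry (0₂ , double l) u ≡ + 1
    adj {u} u∈ = trans (entry-sym (0₂ , double l) u) (adj′ u∈)

  single : ZV 2 r × ZV 2 s → List (G r s)
  single t = involution t ∷ []

  comp-involution : ∀ t → comp (involution {r} {s} t) ≡ involution t
  comp-involution (a , h) = comp-even a (double h) (lowBits-double h)

  singles≢0 : ∀ {t} → t ∈ singles {r} {s} → proj₁ t ≢ 0₂
  singles≢0 t∈ = ∈-nonzero⁻ (proj₁ (∈-cartesianProduct⁻ (nonzero r) _ t∈))

  single≢e : ∀ {t} → t ∈ singles {r} {s} → involution t ≢ e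
  single≢e t∈ eq = singles≢0 t∈ (cong proj₁ eq)

  star≢e : ∀ {l u} → l ≢ 0₂ → u ∈ star l → u ≢ e
  star≢e l≢0 u∈ refl = double≢0 l≢0 (cong proj₂ (trans (sym (∈-star⁻ l≢0 u∈)) comp-e))

  nonidentity≢e : ∀ {u} → u ∈ nonidentity {r} {s} → u ≢ e
  nonidentity≢e u∈ with ∈-++⁻ (concatMap single (singles {r} {s})) u∈
  ... | inj₁ p with t , t∈ , here refl ← find (∈-concatMap⁻ single p) = single≢e t∈
  ... | inj₂ p with l , l∈ , u∈l ← find (∈-concatMap⁻ star p) = star≢e (∈-nonzero⁻ l∈) u∈l

  singles-zero : ∀ {t u} → t ∈ singles {r} {s} → u ∈ singles {r} {s} → t ≢ u → Zero (single t) (single u)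
  singles-zero {a , h} {b , k} t∈ u∈ t≢u (here refl) (here refl) = entry-comp (single≢e t∈) (single≢e u∈)
    (λ eq → let eq′ = trans (sym (comp-involution (a , h))) (trans eq (comp-involution (b , k)))
            in t≢u (cong₂ _,_ (cong proj₁ eq′) (double-injective (cong proj₂ eq′))))

  stars-zero : ∀ {l k} → l ∈ nonzero s → k ∈ nonzero s → l ≢ k → Zero (star l) (star k)
  stars-zero {l} {k} l∈ k∈ l≢k u∈ v∈ = entry-comp (star≢e l≢0 u∈) (star≢e k≢0 v∈)
    (λ eq → l≢k (double-injective (cong proj₂ (trans (sym (∈-star⁻ l≢0 u∈)) (trans eq (∈-star⁻ k≢0 v∈))))))
    where
    l≢0 : l ≢ 0₂
    l≢0 = ∈-nonzero⁻ l∈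
    k≢0 : k ≢ 0₂
    k≢0 = ∈-nonzero⁻ k∈

  -- The first coordinate of `comp` is nonzero for a single and zero throughout a star.
  mixed-zero : Zero (concatMap single (singles {r} {s})) (concatMap star (nonzero s))
  mixed-zero u∈ v∈ with t , t∈ , here refl ← find (∈-concatMap⁻ single u∈) | l , l∈ , v∈l ← find (∈-concatMap⁻ star v∈) =
    entry-comp (single≢e t∈) (star≢e l≢0 v∈l)
      (λ eq → singles≢0 t∈ (cong proj₁ (trans (sym (comp-involution t)) (trans eq (∈-star⁻ l≢0 v∈l)))))
    where
    l≢0 = ∈-nonzero⁻ l∈

  columnSum-arranged : ColSum arranged x
  columnSum-arranged {w} _ = trans (sym (∑-↭ (λ u → entry u w) (elems↭arranged {r} {s′}))) (columnSum (∈-elems r s w))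

  D-nonidentity : ∀ {m′} → m ≡ suc m′ → ColSum nonidentity (x - + 1) →
                  D nonidentity ≡ (x - + 1) ^ (p ℕ.* 2 ℕ.^ s) * starDet m′ ^ q
  D-nonidentity {m′} m≡ sums = begin
    D nonidentity
      ≡⟨ D-++ (concatMap single (singles {r} {s})) (concatMap star (nonzero s)) mixed-zero ⟩
    D (concatMap single (singles {r} {s})) * D (concatMap star (nonzero s))
      ≡⟨ cong₂ _*_
           (D-concatMap single (singles {r} {s}) singles-unique singles-zero
             (ColSum-++ˡ (concatMap single (singles {r} {s})) (concatMap star (nonzero s)) mixed-zero′ sums) (λ {t} _ → D-[] (involution t)))
           (D-concatMap star (nonzero s) (nonzero-unique s) stars-zero
             (ColSum-++ʳ (concatMap single (singles {r} {s})) (concatMap star (nonzero s)) mixed-zero sums) (λ l∈ → D-star m≡ (∈-nonzero⁻ l∈))) ⟩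
    (x - + 1) ^ length (singles {r} {s}) * starDet m′ ^ q
      ≡⟨ cong (λ n → (x - + 1) ^ n * starDet m′ ^ q) (length-singles {r} {s′}) ⟩
    (x - + 1) ^ (p ℕ.* 2 ℕ.^ s) * starDet m′ ^ q ∎
    where
    mixed-zero′ : Zero (concatMap star (nonzero s)) (concatMap single (singles {r} {s}))
    mixed-zero′ {u} {v} u∈ v∈ = trans (entry-sym u v) (mixed-zero v∈ u∈)

  D-elems : ∀ {m′} → m ≡ suc m′ →
            (x - + 1) * D (elems r s) ≡ x * (x - + 2 ℕ.^ (r ℕ.+ 2 ℕ.* s)) * ((x - + 1) ^ (p ℕ.* 2 ℕ.^ s) * starDet m′ ^ q)
  D-elems {m′} m≡ = begin
    (x - + 1) * D (elems r s)
      ≡⟨ cong ((x - + 1) *_) (D-↭ (elems↭arranged {r} {s′})) ⟩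
    (x - + 1) * D arranged
      ≡⟨ D-cone e nonidentity adj adj′ columnSum-arranged ⟩
    x * (x - + length (arranged {r} {s})) * D nonidentity
      ≡⟨ cong₂ (λ n d → x * (x - + n) * d) (trans (sym (length-arranged {r} {s′})) order≡)
               (D-nonidentity m≡ (ColSum-tail e nonidentity adj columnSum-arranged)) ⟩
    x * (x - + 2 ℕ.^ (r ℕ.+ 2 ℕ.* s)) * ((x - + 1) ^ (p ℕ.* 2 ℕ.^ s) * starDet m′ ^ q) ∎
    where
    adj′ : ∀ {u} → u ∈ nonidentity {r} {s} → entry u e ≡ + 1
    adj′ u∈ = entry-adj 0 z≤n (nonidentity≢e u∈) refl
    adj : ∀ {u} → u ∈ nonidentity {r} {s} → entry e u ≡ + 1
    adj {u} u∈ = trans (entry-sym e u) (adj′ u∈)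

  -- The multiplier x - 1 at the identity is not cancelled within the product but put on the claimed
  -- side as well, where it raises the exponent of x - 1 by one.
  eval-claimedPoly : ∀ {m′} → m ≡ suc m′ →
    (x - + 1) * eval x (claimedPoly r s) ≡ x * (x - + 2 ℕ.^ (r ℕ.+ 2 ℕ.* s)) * ((x - + 1) ^ (p ℕ.* 2 ℕ.^ s) * starDet m′ ^ q)
  eval-claimedPoly {m′} m≡ = begin
    y * eval x (claimedPoly r s)
      ≡⟨ cong (y *_) evaluated ⟩
    y * (x * y ^ E₁ * (x - + 2) ^ E₂ * (x - + 4) ^ E₄ * (x - + (2 ℕ.+ 2 ℕ.^ (r ℕ.+ s))) ^ (2 ℕ.^ s ℕ.∸ 1) * (x - + N))
      ≡⟨ cong (y *_) (cong₂ (λ a b → x * y ^ E₁ * a * b * (x - + (2 ℕ.+ 2 ℕ.^ (r ℕ.+ s))) ^ (2 ℕ.^ s ℕ.∸ 1) * (x - + N))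
            (cong₂ _^_ x-2 E₂≡) (cong₂ _^_ x-4 E₄≡)) ⟩
    y * (x * y ^ E₁ * z ^ (m′ ℕ.* q) * (z - + 2) ^ (m ℕ.* q) * (x - + (2 ℕ.+ 2 ℕ.^ (r ℕ.+ s))) ^ (2 ℕ.^ s ℕ.∸ 1) * (x - + N))
      ≡⟨ cong (λ a → y * (x * y ^ E₁ * z ^ (m′ ℕ.* q) * (z - + 2) ^ (m ℕ.* q) * a * (x - + N))) (cong₂ _^_ x-big q≡) ⟩
    y * (x * y ^ E₁ * z ^ (m′ ℕ.* q) * (z - + 2) ^ (m ℕ.* q) * w ^ q * (x - + N))
      ≡⟨ regroup y x (y ^ E₁) (z ^ (m′ ℕ.* q)) ((z - + 2) ^ (m ℕ.* q)) (w ^ q) (x - + N) ⟩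
    x * (x - + N) * (y * y ^ E₁ * (w ^ q * (z ^ (m′ ℕ.* q) * (z - + 2) ^ (m ℕ.* q))))
      ≡⟨ cong (λ n → x * (x - + N) * (y ^ n * (w ^ q * (z ^ (m′ ℕ.* q) * (z - + 2) ^ (m ℕ.* q))))) E₁≡ ⟩
    x * (x - + N) * (y ^ (p ℕ.* 2 ℕ.^ s ℕ.+ q) * (w ^ q * (z ^ (m′ ℕ.* q) * (z - + 2) ^ (m ℕ.* q))))
      ≡⟨ cong (x * (x - + N) *_) (cong (_* (w ^ q * (z ^ (m′ ℕ.* q) * (z - + 2) ^ (m ℕ.* q)))) (^-distribˡ-+-* y (p ℕ.* 2 ℕ.^ s) q)) ⟩
    x * (x - + N) * (y ^ (p ℕ.* 2 ℕ.^ s) * y ^ q * (w ^ q * (z ^ (m′ ℕ.* q) * (z - + 2) ^ (m ℕ.* q))))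
      ≡⟨ cong (x * (x - + N) *_) (*-assoc (y ^ (p ℕ.* 2 ℕ.^ s)) (y ^ q) (w ^ q * (z ^ (m′ ℕ.* q) * (z - + 2) ^ (m ℕ.* q)))) ⟩
    x * (x - + N) * (y ^ (p ℕ.* 2 ℕ.^ s) * (y ^ q * (w ^ q * (z ^ (m′ ℕ.* q) * (z - + 2) ^ (m ℕ.* q)))))
      ≡⟨ cong (λ t → x * (x - + N) * (y ^ (p ℕ.* 2 ℕ.^ s) * t)) starPower ⟨
    x * (x - + N) * (y ^ (p ℕ.* 2 ℕ.^ s) * starDet m′ ^ q) ∎
    where
    y z w : ℤ
    y = x - + 1
    z = x - + 1 - + 1
    w = y - + suc (m ℕ.* 2)
    N E₁ E₂ E₄ : ℕ
    N  = 2 ℕ.^ (r ℕ.+ 2 ℕ.* s)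
    E₁ = 2 ℕ.^ (r ℕ.+ s) ℕ.∸ 2
    E₂ = (2 ℕ.^ s ℕ.∸ 1) ℕ.* (2 ℕ.^ (r ℕ.+ s ℕ.∸ 1) ℕ.∸ 1)
    E₄ = 2 ℕ.^ (r ℕ.+ s ℕ.∸ 1) ℕ.* (2 ℕ.^ s ℕ.∸ 1)

    evaluated : eval x (claimedPoly r s) ≡
      x * y ^ E₁ * (x - + 2) ^ E₂ * (x - + 4) ^ E₄ * (x - + (2 ℕ.+ 2 ℕ.^ (r ℕ.+ s))) ^ (2 ℕ.^ s ℕ.∸ 1) * (x - + N)
    evaluated = trans (eval-⊗ x f₄ (lin (+ N))) (cong₂ _*_
      (power f₃ (+ (2 ℕ.+ 2 ℕ.^ (r ℕ.+ s))) (2 ℕ.^ s ℕ.∸ 1) (power f₂ (+ 4) E₄ (power f₁ (+ 2) E₂ (power X (+ 1) E₁ (eval-X x)))))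
      (eval-lin x (+ N)))
      where
      f₁ f₂ f₃ f₄ : Poly
      f₁ = X ⊗ lin (+ 1) ^P E₁
      f₂ = f₁ ⊗ lin (+ 2) ^P E₂
      f₃ = f₂ ⊗ lin (+ 4) ^P E₄
      f₄ = f₃ ⊗ lin (+ (2 ℕ.+ 2 ℕ.^ (r ℕ.+ s))) ^P (2 ℕ.^ s ℕ.∸ 1)
      power : ∀ f a n {c} → eval x f ≡ c → eval x (f ⊗ lin a ^P n) ≡ c * (x - a) ^ n
      power f a n eq = trans (eval-⊗ x f (lin a ^P n))
        (cong₂ _*_ eq (trans (eval-^P x (lin a) n) (cong (_^ n) (eval-lin x a))))

    x-2 : x - + 2 ≡ z
    x-2 = lemma x
      where
      lemma : ∀ x → x - + 2 ≡ x - + 1 - + 1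
      lemma = solve-∀
    x-4 : x - + 4 ≡ z - + 2
    x-4 = lemma x
      where
      lemma : ∀ x → x - + 4 ≡ x - + 1 - + 1 - + 2
      lemma = solve-∀
    q≡ : 2 ℕ.^ s ℕ.∸ 1 ≡ q
    q≡ = cong (ℕ._∸ 1) (length-nonzero s)
    m≡^ : 2 ℕ.^ (r ℕ.+ s ℕ.∸ 1) ≡ m
    m≡^ = trans (cong (λ n → 2 ℕ.^ (n ℕ.∸ 1)) (ℕ.+-suc r s′)) (ℕ.^-distribˡ-+-* 2 r s′)
    2m≡^ : 2 ℕ.^ (r ℕ.+ s) ≡ m ℕ.* 2
    2m≡^ = trans (cong (2 ℕ.^_) (ℕ.+-suc r s′)) (trans (cong (2 ℕ.*_) (ℕ.^-distribˡ-+-* 2 r s′)) (ℕ.*-comm 2 m))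
    E₂≡ : E₂ ≡ m′ ℕ.* q
    E₂≡ = trans (cong₂ ℕ._*_ q≡ (cong (ℕ._∸ 1) (trans m≡^ m≡))) (ℕ.*-comm q m′)
    E₄≡ : E₄ ≡ m ℕ.* q
    E₄≡ = cong₂ ℕ._*_ m≡^ q≡
    -- The 2 is the depth 1 of a star plus its top vertex; the power of 2 counts the square roots
    -- below that vertex.
    x-big : x - + (2 ℕ.+ 2 ℕ.^ (r ℕ.+ s)) ≡ w
    x-big = trans (cong (λ n → x - + (2 ℕ.+ n)) 2m≡^) (lemma x (+ (m ℕ.* 2)))
      where
      lemma : ∀ x k → x - (+ 2 + k) ≡ x - + 1 - (+ 1 + k)
      lemma = solve-∀
    -- One factor x - 1 for each single and one for each star. The truncated subtraction of 2 in
    -- `E₁` is genuine because `m` is positive.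
    E₁≡ : suc E₁ ≡ p ℕ.* 2 ℕ.^ s ℕ.+ q
    E₁≡ = ℕ.suc-injective (begin
      suc (suc E₁)                     ≡⟨ ℕ.m+[n∸m]≡n (subst (2 ℕ.≤_) (sym (trans 2m≡^ (cong (ℕ._* 2) m≡))) (s≤s (s≤s z≤n))) ⟩
      2 ℕ.^ (r ℕ.+ s)                  ≡⟨ ℕ.^-distribˡ-+-* 2 r s ⟩
      2 ℕ.^ r ℕ.* 2 ℕ.^ s              ≡⟨ cong (ℕ._* 2 ℕ.^ s) (length-nonzero r) ⟩
      2 ℕ.^ s ℕ.+ p ℕ.* 2 ℕ.^ s        ≡⟨ ℕ.+-comm (2 ℕ.^ s) (p ℕ.* 2 ℕ.^ s) ⟩
      p ℕ.* 2 ℕ.^ s ℕ.+ 2 ℕ.^ s        ≡⟨ cong (p ℕ.* 2 ℕ.^ s ℕ.+_) (length-nonzero s) ⟩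
      p ℕ.* 2 ℕ.^ s ℕ.+ suc q          ≡⟨ ℕ.+-suc (p ℕ.* 2 ℕ.^ s) q ⟩
      suc (p ℕ.* 2 ℕ.^ s ℕ.+ q)        ∎)

    regroup : ∀ y x a b c d n → y * (x * a * b * c * d * n) ≡ x * n * (y * a * (d * (b * c)))
    regroup = solve-∀

    starPower : starDet m′ ^ q ≡ y ^ q * (w ^ q * (z ^ (m′ ℕ.* q) * (z - + 2) ^ (m ℕ.* q)))
    starPower = begin
      (y * (w * (z ^ m′ * (z - + 2) ^ m))) ^ q
        ≡⟨ ^-distribʳ-* y _ q ⟩
      y ^ q * (w * (z ^ m′ * (z - + 2) ^ m)) ^ q
        ≡⟨ cong (y ^ q *_) (^-distribʳ-* w _ q) ⟩
      y ^ q * (w ^ q * (z ^ m′ * (z - + 2) ^ m) ^ q)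
        ≡⟨ cong (λ t → y ^ q * (w ^ q * t)) (^-distribʳ-* (z ^ m′) ((z - + 2) ^ m) q) ⟩
      y ^ q * (w ^ q * ((z ^ m′) ^ q * ((z - + 2) ^ m) ^ q))
        ≡⟨ cong₂ (λ a b → y ^ q * (w ^ q * (a * b))) (^-*-assoc z m′ q) (^-*-assoc (z - + 2) m q) ⟩
      y ^ q * (w ^ q * (z ^ (m′ ℕ.* q) * (z - + 2) ^ (m ℕ.* q))) ∎

  eval-equal : eval x (laplacianPoly r s) ≡ eval x (claimedPoly r s)
  eval-equal = *-cancelˡ-≡ (x - + 1) _ _ (begin
    (x - + 1) * eval x (laplacianPoly r s)  ≡⟨ cong ((x - + 1) *_) eval-laplacianPoly ⟩
    (x - + 1) * D (elems r s)               ≡⟨ D-elems m≡ ⟩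
    x * (x - + 2 ℕ.^ (r ℕ.+ 2 ℕ.* s)) * ((x - + 1) ^ (p ℕ.* 2 ℕ.^ s) * starDet (ℕ.pred m) ^ q) ≡⟨ eval-claimedPoly m≡ ⟨
    (x - + 1) * eval x (claimedPoly r s)    ∎)
    where
    m≡ : m ≡ suc (ℕ.pred m)
    m≡ = sym (ℕ.suc-pred m {{ℕ.>-nonZero (ℕ.*-mono-≤ (ℕ.m^n>0 2 r) (ℕ.m^n>0 2 s′))}})

theorem3p12 : (r s : ℕ) → r ≥ 1 → s ≥ 1 →
    (k : ℕ) → coeff (laplacianPoly r s) k ≡ coeff (claimedPoly r s) k
theorem3p12 r (suc s′) r≥1 s≥1 = eventually-equal⇒coeff≡ (laplacianPoly r (suc s′)) (claimedPoly r (suc s′)) 4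
  -- From 4 on, x - 1, x - 2 and x - 3 are positive; with `n` in successor form they compute to
  -- positive integers, so the three `NonZero` instances are found automatically.
  (λ { (suc (suc (suc (suc n)))) (s≤s (s≤s (s≤s (s≤s _)))) → Computation.eval-equal r s′ (+ (4 ℕ.+ n)) })
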